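{- Let $\mathcal R$ be a set of one-step sound one-step rules that is strongly one-step complete (S1SC) for a given $\Lambda$-structure over $T$. Then for every sequent $\Gamma\Rightarrow\Delta$ of $\mathrm{CPL}(\Lambda,\Sigma)$-formulas, $\Gamma\Rightarrow\Delta$ is derivable in $\mathcal{SR}\mathsf{Cut}$ if and only if $\models\Gamma\Rightarrow\Delta$.
   Context: **Syntax.** $\Lambda$ is a set of modal operators and $\Sigma$ a set of predicate symbols with finite arities; $\mathsf{iVar}$ is a set of individual variables, $|\mathsf{iVar}|\ge|\Lambda\cup\Sigma\cup\omega|$. Formulas of $\mathrm{CPL}(\Lambda,\Sigma)$: $\phi::= y_1=y_2\mid P(\vec x)\mid\bot\mid\phi\to\psi\mid\forall x.\phi\mid x\heartsuit\lceil y_1:\phi_1\rceil\dots\lceil y_n:\phi_n\rceil$ ($\heartsuit$ $n$-ary; $x$ free, $y_i$ bound in $\phi_i$). $\phi[t/x]$ is capture-avoiding substitution of the variable $t$ for $x$ (bound variables renamed if necessary). **Semantics.** A $\Lambda$-structure is a functor $T:\mathsf{Set}\to\mathsf{Set}$ with, for each $n$-ary $\heartsuit\in\Lambda$, maps $\llbracket\heartsuit\rrbracket_C:\mathcal P(C)^n\to\mathcal P(TC)$, natural: $(Tf)^{ -1}[\llbracket\heartsuit\rrbracket_D(B_1,\dots,B_n)]=\llbracket\heartsuit\rrbracket_C(f^{ -1}[B_1],\dots,f^{ -1}[B_n])$ for $f:C\to D$. A model is $\mathfrak M=(C,\gamma,I)$ with $\gamma:C\to TC$ and $I$ interpreting $k$-ary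 $P\in\Sigma$ as subsets of $C^k$. Satisfaction under $v:\mathsf{iVar}\to C$ is standard, and $\mathfrak M,v\models x\heartsuit\lceil y_1:\phi_1\rceil\dots\lceil y_n:\phi_n\rceil$ iff $\gamma(v(x))\in\llbracket\heartsuit\rrbracket_C(A_1,\dots,A_n)$, $A_i=\{c\mid\mathfrak M,v[y_i\mapsto c]\models\phi_i\}$. A sequent $\Gamma\Rightarrow\Delta$ is a pair of finite multisets of formulas; $\models\Gamma\Rightarrow\Delta$ means $\mathfrak M,v\models\bigwedge\Gamma\to\bigvee\Delta$ for all models $\mathfrak M$ over the structure and all $v$. **One-step logic.** $\mathsf{sVar}$ is a set of schematic variables (with at least as many elements as there are formulas). $\mathsf{Prop}(D)$: Boolean formulas over $D$; $\Lambda(D)=\{\heartsuit d_1\dots d_n\mid d_i\in D\}$. For $\tau:\mathsf{sVar}\to\mathcal P(C)$ extended to $\mathsf{Prop}(\mathsf{sVar})$ by Boolean operations, $C,\tau\models A$ iff $\tau(A)=C$. For $\phi\in\mathsf{Prop}(\Lambda(\mathsf{Prop}(\mathsf{sVar})))$, $\llbracket\phi\rrbracket_{TC,\tau}\subseteq TC$ is given by $\llbracket\heartsuit A_1\dots A_n\rrbracket_{TC,\tau}=\llbracket\heartsuit\rrbracket_C(\tau(A_1),\dots,\tau(A_n))$ and Boolean operations. A one-step rule $A/X$ has $A\in\mathsf{Prop}(\mathsf{sVar})$ and $X$ a finite disjunction of elements of $\Lambda(\mathsf{sVar})$ and their negations, each schematic variable occurring at most once in $X$, every variable of $A$ occurring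 in $X$. It is one-step sound if $C,\tau\models A$ implies $\llbracket X\rrbracket_{TC,\tau}=TC$, for all $C,\tau$. A set $\Xi\subseteq\mathsf{Prop}(\Lambda(\mathsf{Prop}(\mathsf{sVar})))$ is one-step satisfiable wrt $\tau$ if $\bigcap_{\phi\in\Xi}\llbracket\phi\rrbracket_{TC,\tau}\ne\emptyset$, and one-step consistent wrt $\tau$ if $\Xi\cup\{X\sigma\mid\sigma:\mathsf{sVar}\to\mathsf{Prop}(\mathsf{sVar}),A/X\in\mathcal R,C,\tau\models A\sigma\}$ is propositionally consistent (modalized formulas as atoms). $\mathcal R$ is S1SC if for all $C$, $\Xi$ and $\tau:\mathsf{sVar}\to\mathcal P(C)$, one-step consistency of $\Xi$ wrt $\tau$ implies one-step satisfiability wrt $\tau$. **Sequent system $\mathcal{SR}\mathsf{Cut}$.** Each $R=A/X\in\mathcal R$ is represented in sequent format with premises $\Gamma_1\Rightarrow\Delta_1,\dots,\Gamma_k\Rightarrow\Delta_k$ (multisets of schematic variables) and conclusion $\heartsuit_1\vec p_1,\dots,\heartsuit_n\vec p_n\Rightarrow\heartsuit_{n+1}\vec p_{n+1},\dots,\heartsuit_{n+m}\vec p_{n+m}$, where $A$ is propositionally equivalent to $\bigwedge_i(\bigwedge\Gamma_i\to\bigvee\Delta_i)$ and $X$ to $\bigwedge_{j\le n}\heartsuit_j\vec p_j\to\bigvee_{j>n}\heartsuit_j\vec p_j$. Axioms: $\phi\Rightarrow\phi$; $\bot\Rightarrow$; $\Rightarrow x=x$. Rules (premises / conclusion; $\dagger$: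 $y$ fresh, i.e. not free, in the conclusion): - $\phi,\Gamma\Rightarrow\Delta,\psi\ /\ \Gamma\Rightarrow\Delta,\phi\to\psi$; and $\Gamma\Rightarrow\Delta,\phi$ and $\psi,\Gamma\Rightarrow\Delta\ /\ \phi\to\psi,\Gamma\Rightarrow\Delta$; - $\Gamma\Rightarrow\Delta,\phi[y/x]\ /\ \Gamma\Rightarrow\Delta,\forall x.\phi$ ($\dagger$); $\phi[z/x],\Gamma\Rightarrow\Delta\ /\ \forall x.\phi,\Gamma\Rightarrow\Delta$; - $x=y,\Gamma[x/z]\Rightarrow\Delta[x/z]\ /\ x=y,\Gamma[y/z]\Rightarrow\Delta[y/z]$, and the same rule with premise and conclusion exchanged; - left and right weakening and contraction; - for each $R\in\mathcal R$, $\mathcal S(R)$ ($\dagger$): from $\Sigma',\Gamma_i\sigma\Rightarrow\Delta_i\sigma,\Theta$ ($1\le i\le k$) infer $\Sigma',z\heartsuit_1\lceil\boldsymbol{x_1:\phi_1}\rceil,\dots,z\heartsuit_n\lceil\boldsymbol{x_n:\phi_n}\rceil\Rightarrow z\heartsuit_{n+1}\lceil\boldsymbol{x_{n+1}:\phi_{n+1}}\rceil,\dots,z\heartsuit_{n+m}\lceil\boldsymbol{x_{n+m}:\phi_{n+m}}\rceil,\Theta$, where $\lceil\boldsymbol{x_i:\phi_i}\rceil$ abbreviates $\lceil x_i^1:\phi_i^1\rceil\dots\lceil x_i^{a}:\phi_i^{a}\rceil$ ($a$ the arity of $\heartsuit_i$) and $\sigma$ sends $p_i^j$ to $\phi_i^j[y/x_i^j]$;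 - Cut: $\Gamma\Rightarrow\Delta,\phi$ and $\phi,\Sigma'\Rightarrow\Theta\ /\ \Gamma,\Sigma'\Rightarrow\Delta,\Theta$. -}

module Defs where

open import Data.Bool.Base using (Bool; true; false; not; _∨_; if_then_else_)
open import Data.Empty.Polymorphic using (⊥)
open import Data.Fin.Base using (Fin; toℕ)
open import Data.Fin.Properties using (¬∀⟶∃¬; pigeonhole; toℕ-injective; <⇒≢)
open import Data.List.Base using (List; []; _∷_; [_]; _++_; map; foldr; concat; concatMap; tabulate; filter; length)
open import Data.List.Membership.Propositional using (_∈_; _∉_)
open import Data.List.Membership.Setoid.Properties using (index-injective)
open import Data.List.Relation.Binary.Permutation.Propositional using (_↭_)
open import Data.List.Relation.Binary.Subset.Propositional using (_⊆_)
open import Data.List.Relation.Unary.All using (All)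
open import Data.List.Relation.Unary.Any using (Any; index)
open import Data.List.Relation.Unary.Unique.Propositional using (Unique)
open import Data.Nat.Base as ℕ using (ℕ)
open import Data.Nat.Properties using (n<1+n)
open import Data.Product.Base using (∃-syntax; _×_; _,_; proj₁; proj₂; uncurry)
open import Data.Sum.Base using (_⊎_; inj₂)
open import Data.Vec.Functional using (Vector)
open import Effect.Functor using (RawFunctor)
open import Function.Base using (_∘_; id)
open import Function.Bundles using (_↣_; Injection)
open import Level using (Level; suc)
open import Relation.Binary.Definitions using (DecidableEquality)
open import Relation.Binary.PropositionalEquality using (_≡_; refl; setoid)
open import Relation.Nullary using (¬_; does; ¬?)
open import Relation.Unary using (Pred; _⊢_; _∪_; _≐_; Universal)
  renaming (_∈_ to _∈ₚ_)
import Data.List.Membership.DecPropositional as DecMembership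

------------------------------------------------------------------------
-- Syntax

record Operators (ℓ : Level) : Set (suc ℓ) where
  field
    Λ   : Set ℓ
    arΛ : Λ → ℕ

-- Decidability of equality on variables is used only to define
-- substitution; it is no restriction in the presence of excluded middle.
-- As ω is infinite, the cardinal of Λ ⊎ Σ ⊎ ℕ is that of Λ ∪ Σ ∪ ω.
record Signature {ℓ : Level} (L : Operators ℓ) : Set (suc ℓ) where
  open Operators L
  field
    Σ      : Set ℓ
    arΣ    : Σ → ℕ
    iVar   : Set ℓ
    _≟_    : DecidableEquality iVar
    enough : (Λ ⊎ Σ ⊎ ℕ) ↣ iVar

  _[_↦_] : ∀ {a} {A : Set a} → (iVar → A) → iVar → A → iVar → A
  (f [ x ↦ a ]) w = if does (w ≟ x) then a else f w

  remove : iVar → List iVar → List iVar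
  remove x = filter (λ w → ¬? (w ≟ x))

  open DecMembership _≟_ using (_∈?_)

  private
    var : ℕ → iVar
    var n = Injection.to enough (inj₂ (inj₂ n))

    var-injective : ∀ {m n} → var m ≡ var n → m ≡ n
    var-injective eq with Injection.injective enough eq
    ... | refl = refl

    ∃-fresh : (ws : List iVar) → ∃[ y ] y ∉ ws
    ∃-fresh ws = let i , ∉ws = ¬∀⟶∃¬ n (λ i → var (toℕ i) ∈ ws) (λ i → var (toℕ i) ∈? ws) not-all
                 in  var (toℕ i) , ∉ws
      where
      n : ℕ
      n = ℕ.suc (length ws)

      not-all : ¬ ((i : Fin n) → var (toℕ i) ∈ ws)
      not-all all∈ =
        let i , j , i<j , same = pigeonhole (n<1+n (length ws)) (index ∘ all∈)
        in  <⇒≢ i<j (toℕ-injective (var-injective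
              (index-injective (setoid iVar) (all∈ i) (all∈ j) same)))

  fresh : List iVar → iVar
  fresh ws = proj₁ (∃-fresh ws)

  fresh-∉ : (ws : List iVar) → fresh ws ∉ ws
  fresh-∉ ws = proj₂ (∃-fresh ws)

  avoid : iVar → List iVar → iVar
  avoid x ws = if does (x ∈? ws) then fresh ws else x

module _ {ℓ : Level} {L : Operators ℓ} (S : Signature L) where
  open Operators L
  open Signature S

  -- modal x ♡ ys φs is  x♡⌈y₁:φ₁⌉…⌈yₙ:φₙ⌉.
  infixr 6 _⊃_
  data Formula : Set ℓ where
    _≈_   : iVar → iVar → Formula
    rel   : (P : Σ) → Vector iVar (arΣ P) → Formula
    bot   : Formula
    _⊃_   : Formula → Formula → Formula
    all   : iVar → Formula → Formula
    modal : iVar → (♡ : Λ) → Vector iVar (arΛ ♡) → Vector Formula (arΛ ♡) → Formula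

module _ {ℓ : Level} {L : Operators ℓ} {S : Signature L} where
  open Signature S

  fv : Formula S → List iVar
  fv (x ≈ y)           = x ∷ y ∷ []
  fv (rel P xs)        = tabulate xs
  fv bot               = []
  fv (φ ⊃ ψ)           = fv φ ++ fv ψ
  fv (all x φ)         = remove x (fv φ)
  fv (modal x ♡ ys φs) = x ∷ concat (tabulate λ i → remove (ys i) (fv (φs i)))

  -- The name given to the binder x of φ when ρ is applied below it:
  -- x itself, unless x would capture some ρ w with w ≢ x free in φ.
  binder : (iVar → iVar) → iVar → Formula S → iVar
  binder ρ x φ = avoid x (map ρ (remove x (fv φ)))

  -- Simultaneous capture-avoiding substitution.
  sub : (iVar → iVar) → Formula S → Formula S
  sub ρ (x ≈ y)           = ρ x ≈ ρ y
  sub ρ (rel P xs)        = rel P (ρ ∘ xs)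
  sub ρ bot               = bot
  sub ρ (φ ⊃ ψ)           = sub ρ φ ⊃ sub ρ ψ
  sub ρ (all x φ)         = let x′ = binder ρ x φ in all x′ (sub (ρ [ x ↦ x′ ]) φ)
  sub ρ (modal x ♡ ys φs) =
    let ys′ = λ i → binder ρ (ys i) (φs i)
    in  modal (ρ x) ♡ ys′ (λ i → sub (ρ [ ys i ↦ ys′ i ]) (φs i))

  infix 9 _[_/_]
  _[_/_] : Formula S → iVar → iVar → Formula S
  φ [ t / x ] = sub (id [ x ↦ t ]) φ

------------------------------------------------------------------------
-- Boolean formulas

infixr 6 _⊃_
data Prp {ℓ : Level} (D : Set ℓ) : Set ℓ where
  atom : D → Prp D
  bot  : Prp D
  _⊃_  : Prp D → Prp D → Prp D

module _ {ℓ : Level} {D : Set ℓ} where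

  infix 7 ¬ᵇ_
  ¬ᵇ_ : Prp D → Prp D
  ¬ᵇ A = A ⊃ bot

  _or_ _and_ : Prp D → Prp D → Prp D
  A or B  = ¬ᵇ A ⊃ B
  A and B = ¬ᵇ (A ⊃ ¬ᵇ B)

  ⋁ ⋀ : List (Prp D) → Prp D
  ⋁ = foldr _or_ bot
  ⋀ = foldr _and_ (¬ᵇ bot)

  sequent : List D → List D → Prp D
  sequent Γ Δ = ⋀ (map atom Γ) ⊃ ⋁ (map atom Δ)

  atoms : Prp D → List D
  atoms (atom d) = [ d ]
  atoms bot      = []
  atoms (A ⊃ B)  = atoms A ++ atoms B

  bind : {E : Set ℓ} → Prp D → (D → Prp E) → Prp E
  bind (atom d) σ = σ d
  bind bot      σ = bot
  bind (A ⊃ B)  σ = bind A σ ⊃ bind B σ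

  eval : (D → Bool) → Prp D → Bool
  eval V (atom d) = V d
  eval V bot      = false
  eval V (A ⊃ B)  = not (eval V A) ∨ eval V B

  Tautology : Prp D → Set ℓ
  Tautology A = ∀ V → eval V A ≡ true

  Equivalent : Prp D → Prp D → Set ℓ
  Equivalent A B = ∀ V → eval V A ≡ eval V B

  -- No finite conjunction of elements of Φ is refutable, atoms being
  -- identified only if they are equal as syntactic objects.
  Consistent : Pred (Prp D) ℓ → Set ℓ
  Consistent Φ = ∀ As → All Φ As → ¬ Tautology (¬ᵇ ⋀ As)

  extend : {W : Set ℓ} → (D → Pred W ℓ) → Prp D → Pred W ℓ
  extend τ (atom d) w = τ d w
  extend τ bot      w = ⊥
  extend τ (A ⊃ B)  w = extend τ A w → extend τ B w

------------------------------------------------------------------------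
-- One-step rules

-- Elements of Λ(D).
record Modalized {ℓ : Level} (L : Operators ℓ) (D : Set ℓ) : Set ℓ where
  constructor _$_
  open Operators L
  field
    op   : Λ
    args : Vector D (arΛ op)

open Modalized public

module _ {ℓ : Level} {L : Operators ℓ} where

  mapΛ : {D E : Set ℓ} → (D → E) → Modalized L D → Modalized L E
  mapΛ f (♡ $ ds) = ♡ $ (f ∘ ds)

  vars : {D : Set ℓ} → List (Modalized L D) → List D
  vars = concatMap (tabulate ∘ args)

data Literal {ℓ : Level} (D : Set ℓ) : Set ℓ where
  pos neg : D → Literal D

module _ {ℓ : Level} {D : Set ℓ} where

  under : Literal D → D
  under (pos d) = d
  under (neg d) = d

  literal : Literal D → Prp D
  literal (pos d) = atom d
  literal (neg d) = ¬ᵇ atom d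

-- A rule A/X, with X given by its list of disjuncts.
record OneStepRule {ℓ : Level} (L : Operators ℓ) (sVar : Set ℓ) : Set ℓ where
  field
    A         : Prp sVar
    disjuncts : List (Literal (Modalized L sVar))
    linear    : Unique (vars (map under disjuncts))
    covered   : atoms A ⊆ vars (map under disjuncts)

  X : Prp (Modalized L sVar)
  X = ⋁ (map literal disjuncts)

-- The rule A/X, rewritten with premises Γᵢ ⇒ Δᵢ and conclusion left ⇒ right.
-- As for A/X itself, schematic variables occur once in the conclusion, and
-- those of the premises occur there.
record SequentFormat {ℓ : Level} {L : Operators ℓ} {sVar : Set ℓ}
                     (R : OneStepRule L sVar) : Set ℓ where
  open OneStepRule R using (A; X)
  field
    premises   : List (List sVar × List sVar)
    left right : List (Modalized L sVar)
    premises≈A : Equivalent A (⋀ (map (uncurry sequent) premises))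
    concl≈X    : Equivalent X (sequent left right)
    linear     : Unique (vars (left ++ right))
    covered    : ∀ {Γᵢ Δᵢ} → (Γᵢ , Δᵢ) ∈ premises → Γᵢ ++ Δᵢ ⊆ vars (left ++ right)

------------------------------------------------------------------------
-- Structures and models

-- Subsets of C are predicates on C up to _≐_, which every ⟦ ♡ ⟧ therefore
-- has to respect.
record Structure {ℓ : Level} (L : Operators ℓ) : Set (suc ℓ) where
  open Operators L
  field
    T       : Set ℓ → Set ℓ
    functor : RawFunctor T

  open RawFunctor functor public using (_<$>_)

  field
    <$>-cong : {C D : Set ℓ} {f g : C → D} → (∀ c → f c ≡ g c) → ∀ t → (f <$> t) ≡ (g <$> t)
    <$>-id   : {C : Set ℓ} (t : T C) → (id <$> t) ≡ t
    <$>-∘    : {C D E : Set ℓ} (g : D → E) (f : C → D) (t : T C) →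
               (g ∘ f <$> t) ≡ (g <$> (f <$> t))
    ⟦_⟧      : (♡ : Λ) {C : Set ℓ} → Vector (Pred C ℓ) (arΛ ♡) → Pred (T C) ℓ
    ⟦⟧-cong  : (♡ : Λ) {C : Set ℓ} {As Bs : Vector (Pred C ℓ) (arΛ ♡)} →
               (∀ i → As i ≐ Bs i) → ⟦ ♡ ⟧ As ≐ ⟦ ♡ ⟧ Bs
    natural  : (♡ : Λ) {C D : Set ℓ} (f : C → D) (Bs : Vector (Pred D ℓ) (arΛ ♡)) →
               (f <$>_) ⊢ ⟦ ♡ ⟧ Bs ≐ ⟦ ♡ ⟧ (λ i → f ⊢ Bs i)

module _ {ℓ : Level} {L : Operators ℓ} (𝕋 : Structure L) (S : Signature L) where
  open Signature S
  open Structure 𝕋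

  record Model : Set (suc ℓ) where
    field
      C : Set ℓ
      γ : C → T C
      I : (P : Σ) → Pred (Vector C (arΣ P)) ℓ

  Sat : (𝔐 : Model) → (iVar → Model.C 𝔐) → Formula S → Set ℓ
  Sat 𝔐 v (x ≈ y)           = v x ≡ v y
  Sat 𝔐 v (rel P xs)        = Model.I 𝔐 P (v ∘ xs)
  Sat 𝔐 v bot               = ⊥
  Sat 𝔐 v (φ ⊃ ψ)           = Sat 𝔐 v φ → Sat 𝔐 v ψ
  Sat 𝔐 v (all x φ)         = ∀ c → Sat 𝔐 (v [ x ↦ c ]) φ
  Sat 𝔐 v (modal x ♡ ys φs) =
    ⟦ ♡ ⟧ (λ i c → Sat 𝔐 (v [ ys i ↦ c ]) (φs i)) (Model.γ 𝔐 (v x))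

  Valid : List (Formula S) → List (Formula S) → Set (suc ℓ)
  Valid Γ Δ = ∀ 𝔐 v → All (Sat 𝔐 v) Γ → Any (Sat 𝔐 v) Δ

------------------------------------------------------------------------
-- One-step semantics

module _ {ℓ : Level} {L : Operators ℓ} (𝕋 : Structure L) where
  open Structure 𝕋

  module _ {sVar C : Set ℓ} (τ : sVar → Pred C ℓ) where

    _⊨_ : Prp sVar → Set ℓ
    _⊨_ A = Universal (extend τ A)

    ⟦_⟧₁ : Prp (Modalized L (Prp sVar)) → Pred (T C) ℓ
    ⟦_⟧₁ = extend λ m → ⟦ op m ⟧ (extend τ ∘ args m)

    OneStepSatisfiable : Pred (Prp (Modalized L (Prp sVar))) ℓ → Set ℓ
    OneStepSatisfiable Ξ = ∃[ t ] (∀ φ → φ ∈ₚ Ξ → t ∈ₚ ⟦ φ ⟧₁)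

    data RuleInstance (𝓡 : Pred (OneStepRule L sVar) ℓ) :
                      Pred (Prp (Modalized L (Prp sVar))) ℓ where
      inst : ∀ {R} → R ∈ₚ 𝓡 → (σ : sVar → Prp sVar) → let open OneStepRule R in
             _⊨_ (bind A σ) → RuleInstance 𝓡 (bind X (atom ∘ mapΛ σ))

    OneStepConsistent : Pred (OneStepRule L sVar) ℓ →
                        Pred (Prp (Modalized L (Prp sVar))) ℓ → Set ℓ
    OneStepConsistent 𝓡 Ξ = Consistent (Ξ ∪ RuleInstance 𝓡)

  module _ {sVar : Set ℓ} where

    OneStepSound : OneStepRule L sVar → Set (suc ℓ)
    OneStepSound R = let open OneStepRule R in
      {C : Set ℓ} (τ : sVar → Pred C ℓ) →
      τ ⊨ A → Universal (⟦_⟧₁ τ (bind X (atom ∘ mapΛ atom)))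

    S1SC : Pred (OneStepRule L sVar) ℓ → Set (suc ℓ)
    S1SC 𝓡 = {C : Set ℓ} (τ : sVar → Pred C ℓ) (Ξ : Pred (Prp (Modalized L (Prp sVar))) ℓ) →
             OneStepConsistent τ 𝓡 Ξ → OneStepSatisfiable τ Ξ

------------------------------------------------------------------------
-- The sequent system with cut

-- Γ and Δ are multisets: lists up to the rule exchange.
module _ {ℓ : Level} {L : Operators ℓ} {S : Signature L} where
  open Signature S

  NotFree : iVar → List (Formula S) → List (Formula S) → Set ℓ
  NotFree y Γ Δ = y ∉ concatMap fv (Γ ++ Δ)

  module _ {sVar : Set ℓ} (β : sVar → iVar × Formula S) where

    -- The formula  z♡⌈x¹:φ¹⌉…⌈xᵃ:φᵃ⌉  for  ♡p¹…pᵃ  and  β pʲ = (xʲ , φʲ).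
    instΛ : iVar → Modalized L sVar → Formula S
    instΛ z (♡ $ ps) = modal z ♡ (proj₁ ∘ β ∘ ps) (proj₂ ∘ β ∘ ps)

    inst₀ : iVar → sVar → Formula S
    inst₀ y p = let x , φ = β p in φ [ y / x ]

module _ {ℓ : Level} {L : Operators ℓ} (S : Signature L) {sVar : Set ℓ} {𝓡 : Pred (OneStepRule L sVar) ℓ}
         (format : ∀ {R} → R ∈ₚ 𝓡 → SequentFormat R) where
  open Signature S

  private
    variable
      Γ Γ′ Δ Δ′ Γ₁ Γ₂ Δ₁ Δ₂ : List (Formula S)
      φ ψ : Formula S

  data Derivable : List (Formula S) → List (Formula S) → Set ℓ where
    exchange : Γ ↭ Γ′ → Δ ↭ Δ′ → Derivable Γ Δ → Derivable Γ′ Δ′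

    axiom : ∀ φ → Derivable [ φ ] [ φ ]
    bot-L : Derivable [ bot ] []
    ≈-R   : ∀ x → Derivable [] [ x ≈ x ]

    ⊃-R : Derivable (φ ∷ Γ) (ψ ∷ Δ) → Derivable Γ (φ ⊃ ψ ∷ Δ)
    ⊃-L : Derivable Γ (φ ∷ Δ) → Derivable (ψ ∷ Γ) Δ → Derivable (φ ⊃ ψ ∷ Γ) Δ

    all-R : ∀ {x} y → NotFree y Γ (all x φ ∷ Δ) →
            Derivable Γ (φ [ y / x ] ∷ Δ) → Derivable Γ (all x φ ∷ Δ)
    all-L : ∀ {x} z → Derivable (φ [ z / x ] ∷ Γ) Δ → Derivable (all x φ ∷ Γ) Δ

    ≈-L₁ : ∀ {x y} z →
           Derivable (x ≈ y ∷ map (_[ x / z ]) Γ) (map (_[ x / z ]) Δ) →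
           Derivable (x ≈ y ∷ map (_[ y / z ]) Γ) (map (_[ y / z ]) Δ)
    ≈-L₂ : ∀ {x y} z →
           Derivable (x ≈ y ∷ map (_[ y / z ]) Γ) (map (_[ y / z ]) Δ) →
           Derivable (x ≈ y ∷ map (_[ x / z ]) Γ) (map (_[ x / z ]) Δ)

    weak-L  : Derivable Γ Δ → Derivable (φ ∷ Γ) Δ
    weak-R  : Derivable Γ Δ → Derivable Γ (φ ∷ Δ)
    contr-L : Derivable (φ ∷ φ ∷ Γ) Δ → Derivable (φ ∷ Γ) Δ
    contr-R : Derivable Γ (φ ∷ φ ∷ Δ) → Derivable Γ (φ ∷ Δ)

    -- Choosing the xᵢʲ and φᵢʲ is choosing β on the variables pᵢʲ of the
    -- conclusion, since these are pairwise distinct; no other variables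
    -- occur in the premises.
    rule : ∀ {R} (r : R ∈ₚ 𝓡) (z y : iVar) (β : sVar → iVar × Formula S) →
           let open SequentFormat (format r)
               Γ* = Γ ++ map (instΛ β z) left
               Δ* = map (instΛ β z) right ++ Δ
           in  NotFree y Γ* Δ* →
               (∀ {Γᵢ Δᵢ} → (Γᵢ , Δᵢ) ∈ premises →
                  Derivable (Γ ++ map (inst₀ β y) Γᵢ) (map (inst₀ β y) Δᵢ ++ Δ)) →
               Derivable Γ* Δ*

    cut : Derivable Γ₁ (φ ∷ Δ₁) → Derivable (φ ∷ Γ₂) Δ₂ → Derivable (Γ₁ ++ Γ₂) (Δ₁ ++ Δ₂)

{-# OPTIONS --safe #-}

-- Soundness of S(R): the formulas substituted for the schematic variables
-- define subsets of the model, to which one-step soundness of R applies.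
--
-- Completeness: it suffices to refute an underivable sentence G in a model.
-- Only countably many instances of subformulas of G matter for that,
-- whatever the size of the signature, so a Henkin theory M is obtained in ω
-- steps without Zorn's lemma: for each Boolean combination F(u) of such
-- instances, M is given either ∀u.F(u) or ¬F(h) for a new variable h.  The
-- states of the canonical model are the variables h up to equality in M, and
-- the transition at h is a one-step model, supplied by S1SC, of the modal
-- formulas about h in M.  That these are one-step consistent is where the
-- rules enter: if A σ holds at all states, then ∀u.A σ is in M, and S(R) with
-- this formula in its left context puts X σ for h in M.

module Submission where

open import Defs
open import Axiom.ExcludedMiddle using (ExcludedMiddle)
open import Axiom.Extensionality.Propositional using (Extensionality)
open import Data.Bool.Base using (Bool; true; false)
import Data.Bool.Properties as Bool
open import Data.Empty using (⊥)
import Data.Empty.Polymorphic as Polymorphic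
open import Data.Fin.Base using (Fin)
open import Data.List.Base
  using (List; []; _∷_; _++_; map; concat; concatMap; tabulate; foldr; upTo; cartesianProductWith)
import Data.List.Membership.DecPropositional as DecMembership
open import Data.List.Membership.Propositional using (_∈_; _∉_; find; lose)
open import Data.List.Membership.Propositional.Properties
open import Data.List.Properties using (map-cong-local; map-∘)
open import Data.List.Relation.Binary.Permutation.Propositional using (_↭_; ↭-sym; ↭-refl; prep)
open import Data.List.Relation.Binary.Permutation.Propositional.Properties
  using (All-resp-↭; Any-resp-↭; shift; ++-comm)
open import Data.List.Relation.Binary.Subset.Propositional using (_⊆_)
open import Data.List.Relation.Unary.All as All using (All; []; _∷_)
import Data.List.Relation.Unary.All.Properties as All
open import Data.List.Relation.Unary.Any as Any using (Any; here; there)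
import Data.List.Relation.Unary.Any.Properties as Any
open import Data.Maybe.Base using (Maybe; just; nothing; maybe′)
open import Data.Nat.Base using (ℕ; zero; suc; _≤_; _<_; _⊔_; z≤n; s≤s)
open import Data.Nat.Properties
  using (≤-refl; ≤-trans; ≤-antisym; ≤-pred; ≮⇒≥; <⇒≢; <-cmp; m≤m⊔n; m≤n⊔m; m≤n⇒m<n∨m≡n;
         ≡-irrelevant)
open import Data.Product.Base using (∃-syntax; _×_; _,_; proj₁; proj₂; uncurry)
open import Data.Sum.Base using (_⊎_; inj₁; inj₂; [_,_]′)
open import Data.Vec.Functional using (Vector)
open import Function.Base using (_∘_; id; case_of_)
open import Function.Bundles using (_↣_; _⇔_; mk⇔; Injection; Equivalence)
open import Level using (Level)
open import Relation.Binary.Definitions using (tri<; tri≈; tri>)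
open import Relation.Binary.PropositionalEquality
  using (_≡_; _≢_; refl; sym; trans; cong; cong₂; subst; subst₂)
open import Relation.Nullary using (¬_; yes; no; ¬?; does; contradiction)
open import Relation.Unary using (Pred; Universal) renaming (_∈_ to _∈ₚ_)

open Equivalence using (to; from)

-- Syntax

∈-concat-tabulate⁺ : ∀ {a} {A : Set a} {n} (f : Fin n → List A) i {w} →
                     w ∈ f i → w ∈ concat (tabulate f)
∈-concat-tabulate⁺ f i w∈ = ∈-concat⁺′ w∈ (∈-tabulate⁺ i)

∈-concat-tabulate⁻ : ∀ {a} {A : Set a} {n} (f : Fin n → List A) {w} →
                     w ∈ concat (tabulate f) → ∃[ i ] w ∈ f i
∈-concat-tabulate⁻ f w∈ with ∈-concat⁻′ (tabulate f) w∈
... | _ , w∈′ , fi∈ with ∈-tabulate⁻ fi∈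
... | i , refl = i , w∈′

module Variables {ℓ : Level} {Λ : Operators ℓ} (S : Signature Λ) where
  open Signature S
  open DecMembership _≟_ using (_∈?_)

  module _ {a} {A : Set a} (f : iVar → A) {x : iVar} {c : A} where

    update-≡ : (f [ x ↦ c ]) x ≡ c
    update-≡ with x ≟ x
    ... | yes _  = refl
    ... | no x≢x = contradiction refl x≢x

    update-≢ : ∀ {w} → w ≢ x → (f [ x ↦ c ]) w ≡ f w
    update-≢ {w} w≢x with w ≟ x
    ... | yes w≡x = contradiction w≡x w≢x
    ... | no _    = refl

    update-elim : ∀ {p} (P : iVar → A → Set p) → P x c → (∀ {w} → w ≢ x → P w (f w)) →
                  ∀ w → P w ((f [ x ↦ c ]) w)
    update-elim P px pw w with w ≟ x
    ... | yes refl = px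
    ... | no w≢x   = pw w≢x

  update-self : ∀ {a} {A : Set a} (f : iVar → A) x w → (f [ x ↦ f x ]) w ≡ f w
  update-self f x = update-elim f (λ w a → a ≡ f w) refl λ _ → refl

  update-∘ : ∀ {a b} {A : Set a} {B : Set b} (g : A → B) (f : iVar → A) x c w →
             g ((f [ x ↦ c ]) w) ≡ ((g ∘ f) [ x ↦ g c ]) w
  update-∘ g f x c w with w ≟ x
  ... | yes _ = refl
  ... | no _  = refl

  ∈-remove⁺ : ∀ {w x ws} → w ∈ ws → w ≢ x → w ∈ remove x ws
  ∈-remove⁺ {x = x} = ∈-filter⁺ (λ w → ¬? (w ≟ x))

  ∈-remove⁻ : ∀ {w} x ws → w ∈ remove x ws → w ∈ ws × w ≢ x
  ∈-remove⁻ x ws = ∈-filter⁻ (λ w → ¬? (w ≟ x)) {xs = ws}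

  avoid-∉ : ∀ x ws → avoid x ws ∉ ws
  avoid-∉ x ws with x ∈? ws
  ... | yes _  = fresh-∉ ws
  ... | no x∉  = x∉

  avoid-≡ : ∀ {x ws} → x ∉ ws → avoid x ws ≡ x
  avoid-≡ {x} {ws} x∉ with x ∈? ws
  ... | yes x∈ = contradiction x∈ x∉
  ... | no _   = refl

module Syntax (ext : ∀ {a b} → Extensionality a b)
              {ℓ : Level} {Λ : Operators ℓ} {S : Signature Λ} where
  open Signature S
  open Operators Λ renaming (Λ to Op)
  open Variables S

  bv : Formula S → List iVar
  bv (x ≈ y)           = []
  bv (rel P xs)        = []
  bv bot               = []
  bv (φ ⊃ ψ)           = bv φ ++ bv ψ
  bv (all x φ)         = x ∷ bv φ
  bv (modal x ♡ ys φs) = concat (tabulate λ i → ys i ∷ bv (φs i))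

  modal-cong : ∀ {x x′} {♡ : Op} {ys ys′} {φs φs′ : Vector (Formula S) (arΛ ♡)} →
               x ≡ x′ → (∀ i → ys i ≡ ys′ i) → (∀ i → φs i ≡ φs′ i) →
               modal x ♡ ys φs ≡ modal x′ ♡ ys′ φs′
  modal-cong refl ys≗ φs≗ with ext ys≗ | ext φs≗
  ... | refl | refl = refl

  binder-∉ : ∀ ρ x (φ : Formula S) {w} → w ∈ fv φ → w ≢ x → ρ w ≢ binder ρ x φ
  binder-∉ ρ x φ w∈ w≢x eq =
    avoid-∉ x ws (subst (_∈ ws) eq (∈-map⁺ ρ (∈-remove⁺ w∈ w≢x)))
    where
    ws = map ρ (remove x (fv φ))

  binder-≡ : ∀ ρ x (φ : Formula S) → (∀ {w} → w ∈ fv φ → w ≢ x → ρ w ≢ x) → binder ρ x φ ≡ x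
  binder-≡ ρ x φ safe = avoid-≡ λ x∈ →
    let w , w∈ , x≡ρw = ∈-map⁻ ρ x∈
        w∈φ , w≢x    = ∈-remove⁻ x (fv φ) w∈
    in  safe w∈φ w≢x (sym x≡ρw)

  -- The name chosen by `binder` depends on ρ only through its values at the free variables below
  -- the binder other than x. Agreement there therefore forces the same renamings, and the results
  -- are equal as syntactic objects.
  sub-cong : ∀ (φ : Formula S) {ρ ρ′} → (∀ {w} → w ∈ fv φ → ρ w ≡ ρ′ w) → sub ρ φ ≡ sub ρ′ φ

  sub-cong-under : ∀ x (φ : Formula S) {ρ ρ′} → (∀ {w} → w ∈ remove x (fv φ) → ρ w ≡ ρ′ w) →
                   binder ρ x φ ≡ binder ρ′ x φ ×
                   sub (ρ [ x ↦ binder ρ x φ ]) φ ≡ sub (ρ′ [ x ↦ binder ρ′ x φ ]) φ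
  sub-cong-under x φ {ρ} {ρ′} ρ≗ = b≡ , sub-cong φ agree
    where
    b≡ : binder ρ x φ ≡ binder ρ′ x φ
    b≡ = cong (avoid x) (map-cong-local (All.tabulate ρ≗))

    agree : ∀ {w} → w ∈ fv φ → (ρ [ x ↦ binder ρ x φ ]) w ≡ (ρ′ [ x ↦ binder ρ′ x φ ]) w
    agree {w} w∈ with w ≟ x
    ... | yes _  = b≡
    ... | no w≢x = ρ≗ (∈-remove⁺ w∈ w≢x)

  sub-cong (x ≈ y)    ρ≗ = cong₂ _≈_ (ρ≗ (here refl)) (ρ≗ (there (here refl)))
  sub-cong (rel P xs) ρ≗ = cong (rel P) (ext λ i → ρ≗ (∈-tabulate⁺ i))
  sub-cong bot        ρ≗ = refl
  sub-cong (φ ⊃ ψ)    ρ≗ = cong₂ _⊃_ (sub-cong φ (ρ≗ ∘ ∈-++⁺ˡ)) (sub-cong ψ (ρ≗ ∘ ∈-++⁺ʳ (fv φ)))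
  sub-cong (all x φ)  ρ≗ = let b≡ , φ≡ = sub-cong-under x φ ρ≗ in cong₂ all b≡ φ≡
  sub-cong (modal x ♡ ys φs) {ρ} {ρ′} ρ≗ =
    modal-cong (ρ≗ (here refl)) (proj₁ ∘ under-i) (proj₂ ∘ under-i)
    where
    under-i = λ i → sub-cong-under (ys i) (φs i) {ρ} {ρ′} (ρ≗ ∘ there ∘ ∈-concat-tabulate⁺ _ i)

  -- The identity captures nothing, so every binder keeps its name.
  sub-id : ∀ (φ : Formula S) {ρ} → (∀ w → ρ w ≡ w) → sub ρ φ ≡ φ

  sub-id-under : ∀ x (φ : Formula S) {ρ} → (∀ w → ρ w ≡ w) →
                 binder ρ x φ ≡ x × sub (ρ [ x ↦ binder ρ x φ ]) φ ≡ φ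
  sub-id-under x φ {ρ} ρ≗ = b≡ , sub-id φ (update-elim ρ (λ w v → v ≡ w) b≡ (λ _ → ρ≗ _))
    where
    b≡ : binder ρ x φ ≡ x
    b≡ = binder-≡ ρ x φ λ _ w≢x → w≢x ∘ trans (sym (ρ≗ _))

  sub-id (x ≈ y)    ρ≗ = cong₂ _≈_ (ρ≗ x) (ρ≗ y)
  sub-id (rel P xs) ρ≗ = cong (rel P) (ext (ρ≗ ∘ xs))
  sub-id bot        ρ≗ = refl
  sub-id (φ ⊃ ψ)    ρ≗ = cong₂ _⊃_ (sub-id φ ρ≗) (sub-id ψ ρ≗)
  sub-id (all x φ)  ρ≗ = let b≡ , φ≡ = sub-id-under x φ ρ≗ in cong₂ all b≡ φ≡
  sub-id (modal x ♡ ys φs) ρ≗ =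
    modal-cong (ρ≗ x) (λ i → proj₁ (sub-id-under (ys i) (φs i) ρ≗))
                      (λ i → proj₂ (sub-id-under (ys i) (φs i) ρ≗))

  sub-fixed : ∀ (φ : Formula S) {ρ} → (∀ {w} → w ∈ fv φ → ρ w ≡ w) → sub ρ φ ≡ φ
  sub-fixed φ fixed = trans (sub-cong φ fixed) (sub-id φ {id} λ _ → refl)

  sub-absent : ∀ {t x} (φ : Formula S) → x ∉ fv φ → φ [ t / x ] ≡ φ
  sub-absent φ x∉ = sub-fixed φ λ w∈ → update-≢ id λ where refl → x∉ w∈

  fv-sub : ∀ ρ (φ : Formula S) {w} → w ∈ fv (sub ρ φ) → ∃[ v ] v ∈ fv φ × w ≡ ρ v

  fv-sub-under : ∀ ρ x (φ : Formula S) {w} →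
                 let x′ = binder ρ x φ in
                 w ∈ remove x′ (fv (sub (ρ [ x ↦ x′ ]) φ)) → ∃[ v ] v ∈ remove x (fv φ) × w ≡ ρ v
  fv-sub-under ρ x φ w∈ with ∈-remove⁻ _ (fv (sub (ρ [ x ↦ binder ρ x φ ]) φ)) w∈
  ... | w∈′ , w≢x′ with fv-sub (ρ [ x ↦ binder ρ x φ ]) φ w∈′
  ... | v , v∈ , eq with v ≟ x
  ... | yes _  = contradiction eq w≢x′
  ... | no v≢x = v , ∈-remove⁺ v∈ v≢x , eq

  fv-sub ρ (x ≈ y) (here eq)         = x , here refl , eq
  fv-sub ρ (x ≈ y) (there (here eq)) = y , there (here refl) , eq
  fv-sub ρ (rel P xs) w∈ = let i , eq = ∈-tabulate⁻ w∈ in xs i , ∈-tabulate⁺ i , eq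
  fv-sub ρ (φ ⊃ ψ) w∈ with ∈-++⁻ (fv (sub ρ φ)) w∈
  ... | inj₁ w∈φ = let v , v∈ , eq = fv-sub ρ φ w∈φ in v , ∈-++⁺ˡ v∈ , eq
  ... | inj₂ w∈ψ = let v , v∈ , eq = fv-sub ρ ψ w∈ψ in v , ∈-++⁺ʳ (fv φ) v∈ , eq
  fv-sub ρ (all x φ) w∈ = fv-sub-under ρ x φ w∈
  fv-sub ρ (modal x ♡ ys φs) (here eq)  = x , here refl , eq
  fv-sub ρ (modal x ♡ ys φs) (there w∈) =
    let i , w∈i     = ∈-concat-tabulate⁻ _ w∈
        v , v∈ , eq = fv-sub-under ρ (ys i) (φs i) w∈i
    in  v , there (∈-concat-tabulate⁺ _ i v∈) , eq

  ∉-fv-[/] : ∀ {t z} (φ : Formula S) → t ≢ z → z ∉ fv (φ [ t / z ])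
  ∉-fv-[/] {t} {z} φ t≢z z∈ with fv-sub (id [ z ↦ t ]) φ z∈
  ... | v , _ , eq with v ≟ z
  ... | yes _  = t≢z (sym eq)
  ... | no v≢z = v≢z (sym eq)

  -- A substitution whose new values are not bound variables renames no
  -- binder, so that the usual laws hold up to equality rather than up to
  -- renaming of bound variables.
  module Capture-free (B : List iVar) where

    -- The first alternative lets ρ fix variables of `B`, as the updates `[ x ↦ x ]` below binders
    -- do; a fixed w other than x is not captured by x either.
    Avoids : (iVar → iVar) → Set ℓ
    Avoids ρ = ∀ w → ρ w ≡ w ⊎ ρ w ∉ B

    update-avoids : ∀ {ρ t} x → Avoids ρ → t ≡ x ⊎ t ∉ B → Avoids (ρ [ x ↦ t ])
    update-avoids {ρ} x avoids t-ok = update-elim ρ (λ w v → v ≡ w ⊎ v ∉ B) t-ok (λ _ → avoids _)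

    binder-avoids : ∀ {ρ x} → Avoids ρ → x ∈ B → ∀ (φ : Formula S) → binder ρ x φ ≡ x
    binder-avoids {ρ} {x} avoids x∈B φ = binder-≡ ρ x φ go
      where
      go : ∀ {w} → w ∈ fv φ → w ≢ x → ρ w ≢ x
      go {w} _ w≢x ρw≡x with avoids w
      ... | inj₁ ρw≡w = w≢x (trans (sym ρw≡w) ρw≡x)
      ... | inj₂ ρw∉  = ρw∉ (subst (_∈ B) (sym ρw≡x) x∈B)

    sub-all : ∀ {ρ x} → Avoids ρ → x ∈ B → ∀ φ → sub ρ (all x φ) ≡ all x (sub (ρ [ x ↦ x ]) φ)
    sub-all {ρ} {x} avoids x∈B φ rewrite binder-avoids avoids x∈B φ = refl

    sub-modal : ∀ {ρ} x {♡ : Op} {ys φs} → Avoids ρ → (∀ i → ys i ∈ B) →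
                sub ρ (modal x ♡ ys φs) ≡ modal (ρ x) ♡ ys (λ i → sub (ρ [ ys i ↦ ys i ]) (φs i))
    sub-modal {ρ} x {ys = ys} {φs} avoids ys∈B = modal-cong refl b≡ λ i →
      cong (λ t → sub (ρ [ ys i ↦ t ]) (φs i)) (b≡ i)
      where
      b≡ : ∀ i → binder ρ (ys i) (φs i) ≡ ys i
      b≡ i = binder-avoids avoids (ys∈B i) (φs i)

    -- Proved first for the composite `ρ₂ ∘ ρ₁`, which inherits `Avoids`. As ρ₃ is known only on the
    -- free variables of φ, it enters last, by `sub-cong`.
    sub-∘ : ∀ {ρ₁ ρ₂ ρ₃} → Avoids ρ₁ → Avoids ρ₂ → ∀ φ → bv φ ⊆ B →
            (∀ {w} → w ∈ fv φ → ρ₂ (ρ₁ w) ≡ ρ₃ w) → sub ρ₂ (sub ρ₁ φ) ≡ sub ρ₃ φ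

    sub-∘-under : ∀ {ρ₁ ρ₂ ρ₃ x} → Avoids ρ₁ → Avoids ρ₂ → Avoids ρ₃ → x ∈ B → ∀ φ → bv φ ⊆ B →
                  (∀ {w} → w ∈ remove x (fv φ) → ρ₂ (ρ₁ w) ≡ ρ₃ w) →
                  sub (ρ₂ [ x ↦ x ]) (sub (ρ₁ [ x ↦ x ]) φ) ≡ sub (ρ₃ [ x ↦ x ]) φ
    sub-∘-under {ρ₁} {ρ₂} {ρ₃} {x} av₁ av₂ av₃ x∈B φ bv⊆ comp =
      sub-∘ (update-avoids x av₁ (inj₁ refl)) (update-avoids x av₂ (inj₁ refl)) φ bv⊆ agree
      where
      agree : ∀ {w} → w ∈ fv φ → (ρ₂ [ x ↦ x ]) ((ρ₁ [ x ↦ x ]) w) ≡ (ρ₃ [ x ↦ x ]) w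
      agree {w} w∈ with w ≟ x
      ... | yes _  = update-≡ ρ₂
      -- In both cases `ρ₁ w` differs from x: it is either w itself or outside `B`, to which x
      -- belongs. So the update of ρ₂ at x is not seen.
      ... | no w≢x with av₁ w
      ...   | inj₁ ρw≡w = trans (update-≢ ρ₂ (λ e → w≢x (trans (sym ρw≡w) e)))
                                  (comp (∈-remove⁺ w∈ w≢x))
      ...   | inj₂ ρw∉  = trans (update-≢ ρ₂ (λ e → ρw∉ (subst (_∈ B) (sym e) x∈B)))
                                  (comp (∈-remove⁺ w∈ w≢x))

    ∘-avoids : ∀ {ρ₁ ρ₂} → Avoids ρ₁ → Avoids ρ₂ → Avoids (ρ₂ ∘ ρ₁)
    ∘-avoids {ρ₁} {ρ₂} av₁ av₂ w with av₂ (ρ₁ w)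
    ... | inj₂ ∉B = inj₂ ∉B
    ... | inj₁ e₂ rewrite e₂ = av₁ w

    private
      sub-∘′ : ∀ {ρ₁ ρ₂} → Avoids ρ₁ → Avoids ρ₂ → ∀ φ → bv φ ⊆ B → sub ρ₂ (sub ρ₁ φ) ≡ sub (ρ₂ ∘ ρ₁) φ
      sub-∘′ av₁ av₂ (x ≈ y)    bv⊆ = refl
      sub-∘′ av₁ av₂ (rel P xs) bv⊆ = refl
      sub-∘′ av₁ av₂ bot        bv⊆ = refl
      sub-∘′ av₁ av₂ (φ ⊃ ψ)    bv⊆ =
        cong₂ _⊃_ (sub-∘′ av₁ av₂ φ (bv⊆ ∘ ∈-++⁺ˡ)) (sub-∘′ av₁ av₂ ψ (bv⊆ ∘ ∈-++⁺ʳ (bv φ)))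
      sub-∘′ {ρ₁} {ρ₂} av₁ av₂ (all x φ) bv⊆ =
        trans (cong (sub ρ₂) (sub-all av₁ x∈B φ))
        (trans (sub-all av₂ x∈B _)
        (trans (cong (all x) (sub-∘-under av₁ av₂ (∘-avoids av₁ av₂) x∈B φ (bv⊆ ∘ there) λ _ → refl))
               (sym (sub-all (∘-avoids av₁ av₂) x∈B φ))))
        where
        x∈B = bv⊆ (here refl)
      sub-∘′ {ρ₁} {ρ₂} av₁ av₂ (modal x ♡ ys φs) bv⊆ =
        trans (cong (sub ρ₂) (sub-modal x {ys = ys} {φs} av₁ ys∈B))
        (trans (sub-modal (ρ₁ x) {ys = ys} av₂ ys∈B)
        (trans (modal-cong refl (λ _ → refl) λ i →
                  sub-∘-under av₁ av₂ (∘-avoids av₁ av₂) (ys∈B i) (φs i)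
                    (bv⊆ ∘ ∈-concat-tabulate⁺ _ i ∘ there) λ _ → refl)
               (sym (sub-modal x {ys = ys} {φs} (∘-avoids av₁ av₂) ys∈B))))
        where
        ys∈B : ∀ i → ys i ∈ B
        ys∈B i = bv⊆ (∈-concat-tabulate⁺ _ i (here refl))

    sub-∘ av₁ av₂ φ bv⊆ comp = trans (sub-∘′ av₁ av₂ φ bv⊆) (sub-cong φ comp)

-- Soundness

module _ {ℓ} {D : Set ℓ} (V : D → Bool) where

  eval-⊃ : ∀ A B → eval V (A ⊃ B) ≡ true ⇔ (eval V A ≡ true → eval V B ≡ true)
  eval-⊃ A B with eval V A | eval V B
  ... | true  | true  = mk⇔ (λ _ _ → refl) (λ _ → refl)
  ... | true  | false = mk⇔ (λ ()) (λ f → f refl)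
  ... | false | _     = mk⇔ (λ _ ()) (λ _ → refl)

  eval-⋀ : ∀ As → eval V (⋀ As) ≡ true ⇔ All (λ A → eval V A ≡ true) As
  eval-⋀ []       = mk⇔ (λ _ → []) (λ _ → refl)
  eval-⋀ (A ∷ As) with eval V A in eq | eval V (⋀ As) | eval-⋀ As
  ... | true  | true  | ih = mk⇔ (λ _ → eq ∷ to ih refl) (λ _ → refl)
  ... | true  | false | ih = mk⇔ (λ ()) (λ where (_ ∷ as) → from ih as)
  ... | false | _     | ih = mk⇔ (λ ()) (λ where (a ∷ _) → trans (sym eq) a)

  eval-⋁ : ∀ As → eval V (⋁ As) ≡ true ⇔ Any (λ A → eval V A ≡ true) As
  eval-⋁ []       = mk⇔ (λ ()) (λ ())
  eval-⋁ (A ∷ As) with eval V A in eq | eval V (⋁ As) | eval-⋁ As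
  ... | true  | _     | ih = mk⇔ (λ _ → here eq) (λ _ → refl)
  ... | false | true  | ih = mk⇔ (λ _ → there (to ih refl)) (λ _ → refl)
  ... | false | false | ih = mk⇔ (λ ())
    (λ where (here a) → trans (sym eq) a ; (there as) → from ih as)

  eval-sequent : ∀ Γ Δ → eval V (sequent Γ Δ) ≡ true ⇔
                 (All (λ d → V d ≡ true) Γ → Any (λ d → V d ≡ true) Δ)
  eval-sequent Γ Δ = mk⇔
    (λ e → Any.map⁻ ∘ to (eval-⋁ (map atom Δ)) ∘ to (eval-⊃ (⋀ (map atom Γ)) (⋁ (map atom Δ))) e
           ∘ from (eval-⋀ (map atom Γ)) ∘ All.map⁺)
    (λ f → from (eval-⊃ (⋀ (map atom Γ)) (⋁ (map atom Δ)))
             (from (eval-⋁ (map atom Δ)) ∘ Any.map⁺ ∘ f ∘ All.map⁻ ∘ to (eval-⋀ (map atom Γ))))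

extend-bind : ∀ {ℓ} {D E W : Set ℓ} (τ : E → Pred W ℓ) (A : Prp D) (σ : D → Prp E) {w} →
              extend τ (bind A σ) w ≡ extend (extend τ ∘ σ) A w
extend-bind τ (atom d) σ = refl
extend-bind τ bot      σ = refl
extend-bind τ (A ⊃ B)  σ = cong₂ (λ P Q → P → Q) (extend-bind τ A σ) (extend-bind τ B σ)

module Classical (em : ∀ {a} → ExcludedMiddle a) where

  module _ {a} {P : Set a} where

    does-em : does (em {P = P}) ≡ true ⇔ P
    does-em with em {P = P}
    ... | yes p = mk⇔ (λ _ → p) (λ _ → refl)
    ... | no ¬p = mk⇔ (λ ()) (λ p → contradiction p ¬p)

    by-contradiction : ¬ ¬ P → P
    by-contradiction ¬¬p with em {P = P}
    ... | yes p = p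
    ... | no ¬p = contradiction ¬p ¬¬p

  -- At a fixed point, the set semantics is a Boolean valuation. This makes `premises≈A` and
  -- `concl≈X`, which speak of valuations, applicable in a model.
  extend⇔eval : ∀ {ℓ} {D W : Set ℓ} (τ : D → Pred W ℓ) A {w} →
                extend τ A w ⇔ eval (λ d → does (em {P = τ d w})) A ≡ true
  extend⇔eval τ (atom d) = mk⇔ (from does-em) (to does-em)
  extend⇔eval τ bot      = mk⇔ (λ ()) (λ ())
  extend⇔eval τ (A ⊃ B)  = mk⇔
    (λ f → from (eval-⊃ _ A B) (to (extend⇔eval τ B) ∘ f ∘ from (extend⇔eval τ A)))
    (λ e → from (extend⇔eval τ B) ∘ to (eval-⊃ _ A B) e ∘ to (extend⇔eval τ A))

∈-vars⁻ : ∀ {ℓ} {L : Operators ℓ} {D : Set ℓ} (ms : List (Modalized L D)) {p} →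
          p ∈ vars ms → ∃[ m ] ∃[ i ] m ∈ ms × p ≡ args m i
∈-vars⁻ ms p∈ with ∈-concat⁻′ (map (tabulate ∘ args) ms) p∈
... | _ , p∈ps , ps∈ with ∈-map⁻ (tabulate ∘ args) ps∈
... | m , m∈ , refl = let i , eq = ∈-tabulate⁻ p∈ps in m , i , m∈ , eq

module _ {ℓ} {Λ : Operators ℓ} {S : Signature Λ} where
  open Signature S

  not-free : ∀ {y} {Γ Δ : List (Formula S)} → NotFree y Γ Δ → ∀ {φ} → φ ∈ Γ ++ Δ → y ∉ fv φ
  not-free y∉ φ∈ y∈ = y∉ (∈-concat⁺′ y∈ (∈-map⁺ fv φ∈))

module Soundness (em : ∀ {a} → ExcludedMiddle a) (ext : ∀ {a b} → Extensionality a b)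
                 {ℓ : Level} {Λ : Operators ℓ} (𝕋 : Structure Λ) {S : Signature Λ} where
  open Signature S
  open Structure 𝕋
  open Variables S
  open Syntax ext {S = S}
  open Classical em

  module _ (𝔐 : Model 𝕋 S) where
    open Model 𝔐

    infix 4 _⊩_
    _⊩_ : (iVar → C) → Formula S → Set ℓ
    v ⊩ φ = Sat 𝕋 S 𝔐 v φ

    Sat-cong : ∀ φ {v v′} → (∀ {w} → w ∈ fv φ → v w ≡ v′ w) → v ⊩ φ → v′ ⊩ φ
    Sat-cong-under : ∀ x φ {v v′} c → (∀ {w} → w ∈ remove x (fv φ) → v w ≡ v′ w) →
                     v [ x ↦ c ] ⊩ φ → v′ [ x ↦ c ] ⊩ φ
    Sat-cong-under x φ {v} {v′} c v≗ = Sat-cong φ agree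
      where
      agree : ∀ {w} → w ∈ fv φ → (v [ x ↦ c ]) w ≡ (v′ [ x ↦ c ]) w
      agree {w} w∈ with w ≟ x
      ... | yes _  = refl
      ... | no w≢x = v≗ (∈-remove⁺ w∈ w≢x)

    Sat-cong (x ≈ y)    v≗ e = trans (sym (v≗ (here refl))) (trans e (v≗ (there (here refl))))
    Sat-cong (rel P xs) v≗   = subst (I P) (ext λ i → v≗ (∈-tabulate⁺ i))
    Sat-cong (φ ⊃ ψ)    v≗ f =
      Sat-cong ψ (v≗ ∘ ∈-++⁺ʳ (fv φ)) ∘ f ∘ Sat-cong φ (sym ∘ v≗ ∘ ∈-++⁺ˡ)
    Sat-cong (all x φ)  v≗ f c = Sat-cong-under x φ c v≗ (f c)
    Sat-cong (modal x ♡ ys φs) {v} {v′} v≗ s =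
      subst (⟦ ♡ ⟧ _ ∘ γ) (v≗ (here refl)) (proj₁ (⟦⟧-cong ♡ λ i →
        (λ {c} → Sat-cong-under (ys i) (φs i) c (agree i)) ,
        (λ {c} → Sat-cong-under (ys i) (φs i) c (sym ∘ agree i))) s)
      where
      agree : ∀ i {w} → w ∈ remove (ys i) (fv (φs i)) → v w ≡ v′ w
      agree i w∈ = v≗ (there (∈-concat-tabulate⁺ _ i w∈))

    -- The substitution lemma. By `binder-∉` no free w other than x is sent to the new name x′ of
    -- the binder, so that updating at x′ affects only what came from x.
    Sat-sub : ∀ φ {v ρ} → v ⊩ sub ρ φ ⇔ v ∘ ρ ⊩ φ

    Sat-sub-under : ∀ x φ {v ρ} c → let x′ = binder ρ x φ in
                    v [ x′ ↦ c ] ⊩ sub (ρ [ x ↦ x′ ]) φ ⇔ (v ∘ ρ) [ x ↦ c ] ⊩ φ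
    Sat-sub-under x φ {v} {ρ} c = mk⇔
      (Sat-cong φ agree ∘ to (Sat-sub φ))
      (from (Sat-sub φ) ∘ Sat-cong φ (sym ∘ agree))
      where
      x′ = binder ρ x φ
      agree : ∀ {w} → w ∈ fv φ → (v [ x′ ↦ c ]) ((ρ [ x ↦ x′ ]) w) ≡ ((v ∘ ρ) [ x ↦ c ]) w
      agree {w} w∈ with w ≟ x
      ... | yes _  = update-≡ v
      ... | no w≢x = update-≢ v (binder-∉ ρ x φ w∈ w≢x)

    Sat-sub (x ≈ y)    = mk⇔ id id
    Sat-sub (rel P xs) = mk⇔ id id
    Sat-sub bot        = mk⇔ id id
    Sat-sub (φ ⊃ ψ)    = mk⇔
      (λ f → to (Sat-sub ψ) ∘ f ∘ from (Sat-sub φ)) (λ f → from (Sat-sub ψ) ∘ f ∘ to (Sat-sub φ))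
    Sat-sub (all x φ)  = mk⇔
      (λ f c → to (Sat-sub-under x φ c) (f c)) (λ f c → from (Sat-sub-under x φ c) (f c))
    Sat-sub (modal x ♡ ys φs) {v} {ρ} = mk⇔ (proj₁ ≐) (proj₂ ≐)
      where
      ≐ = ⟦⟧-cong ♡ λ i → (λ {c} → to (Sat-sub-under (ys i) (φs i) c)) ,
                          (λ {c} → from (Sat-sub-under (ys i) (φs i) c))

    Sat-[/] : ∀ φ {v x t} → v ⊩ φ [ t / x ] ⇔ v [ x ↦ v t ] ⊩ φ
    Sat-[/] φ {v} {x} {t} = mk⇔
      (Sat-cong φ (λ _ → update-∘ v id x t _) ∘ to (Sat-sub φ))
      (from (Sat-sub φ) ∘ Sat-cong φ (λ _ → sym (update-∘ v id x t _)))

    Sat-[/]-≡ : ∀ φ {v x t t′} → v t ≡ v t′ → v ⊩ φ [ t / x ] → v ⊩ φ [ t′ / x ]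
    Sat-[/]-≡ φ {v} {x} e = from (Sat-[/] φ) ∘ subst (λ c → v [ x ↦ c ] ⊩ φ) e ∘ to (Sat-[/] φ)

    Sat-fresh : ∀ φ {v y c} → y ∉ fv φ → v ⊩ φ ⇔ v [ y ↦ c ] ⊩ φ
    Sat-fresh φ {v} {y} {c} y∉ = mk⇔ (Sat-cong φ (sym ∘ agree)) (Sat-cong φ agree)
      where
      agree : ∀ {w} → w ∈ fv φ → (v [ y ↦ c ]) w ≡ v w
      agree w∈ = update-≢ v λ where refl → y∉ w∈

    -- The condition on y admits x itself, just as `NotFree` does in the rules with a fresh
    -- variable.
    Sat-[fresh/] : ∀ φ {v x y c} → y ∉ remove x (fv φ) →
                   v [ y ↦ c ] ⊩ φ [ y / x ] ⇔ v [ x ↦ c ] ⊩ φ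
    Sat-[fresh/] φ {v} {x} {y} {c} y∉ = mk⇔
      (Sat-cong φ agree ∘ to (Sat-[/] φ)) (from (Sat-[/] φ) ∘ Sat-cong φ (sym ∘ agree))
      where
      agree : ∀ {w} → w ∈ fv φ → ((v [ y ↦ c ]) [ x ↦ (v [ y ↦ c ]) y ]) w ≡ (v [ x ↦ c ]) w
      agree {w} w∈ with w ≟ x
      ... | yes _  = update-≡ v
      ... | no w≢x = update-≢ v λ where refl → y∉ (∈-remove⁺ w∈ w≢x)

  module _ {sVar : Set ℓ} {𝓡 : Pred (OneStepRule Λ sVar) ℓ}
           (format : ∀ {R} → R ∈ₚ 𝓡 → SequentFormat R)
           (rules-sound : ∀ {R} → R ∈ₚ 𝓡 → OneStepSound 𝕋 R) where

    -- The one-step rule needs A at all c simultaneously, while a premise might hold at some c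
    -- through Δ alone. Hence the argument is by contradiction: once `Δ*` is assumed false at v, it
    -- stays false under every update of the fresh y, and each premise must hold through its
    -- schematic part.
    rule-sound : ∀ {R} (r : R ∈ₚ 𝓡) z y (β : sVar → iVar × Formula S) {Γ Δ} →
      let open SequentFormat (format r)
          Γ* = Γ ++ map (instΛ β z) left
          Δ* = map (instΛ β z) right ++ Δ
      in  NotFree y Γ* Δ* →
          (∀ {Γᵢ Δᵢ} → (Γᵢ , Δᵢ) ∈ premises →
             Valid 𝕋 S (Γ ++ map (inst₀ β y) Γᵢ) (map (inst₀ β y) Δᵢ ++ Δ)) →
          Valid 𝕋 S Γ* Δ*
    rule-sound {R} r z y β {Γ} {Δ} y∉ prems 𝔐 v γs = by-contradiction λ none →
      let X-true     = trans (sym (concl≈X V)) (to (extend⇔eval κ X) (X-holds none))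
          some-right = to (eval-sequent V left right) X-true (All.map (from does-em) left-true)
      in  none (Any.++⁺ˡ (Any.map⁺ (Any.map (to does-em) some-right)))
      where
      open SequentFormat (format r)
      open OneStepRule R using (A; X)
      open Model 𝔐

      Γ* = Γ ++ map (instΛ β z) left
      Δ* = map (instΛ β z) right ++ Δ

      τ : sVar → Pred C ℓ
      τ p c = Sat 𝕋 S 𝔐 (v [ proj₁ (β p) ↦ c ]) (proj₂ (β p))

      κ : Modalized Λ sVar → Pred (T C) ℓ
      κ m = ⟦ op m ⟧ (τ ∘ args m)

      V : Modalized Λ sVar → Bool
      V m = does (em {P = κ m (γ (v z))})

      left-true : All (λ m → κ m (γ (v z))) left
      left-true = All.map⁻ (All.++⁻ʳ Γ γs)

      modal∈ : ∀ {m} → m ∈ left ++ right → instΛ β z m ∈ Γ* ++ Δ*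
      modal∈ m∈ with ∈-++⁻ left m∈
      ... | inj₁ m∈l = ∈-++⁺ˡ (∈-++⁺ʳ Γ (∈-map⁺ (instΛ β z) m∈l))
      ... | inj₂ m∈r = ∈-++⁺ʳ Γ* (∈-++⁺ˡ (∈-map⁺ (instΛ β z) m∈r))

      -- Only for p in the conclusion does the side condition keep y from being free in the formula
      -- of p, its abstracted variable apart; `covered` guarantees this for the premises.
      inst₀⇔τ : ∀ {p c} → p ∈ vars (left ++ right) →
                Sat 𝕋 S 𝔐 (v [ y ↦ c ]) (inst₀ β y p) ⇔ τ p c
      inst₀⇔τ p∈ with ∈-vars⁻ (left ++ right) p∈
      ... | m , i , m∈ , refl = Sat-[fresh/] 𝔐 (proj₂ (β (args m i))) λ y∈ →
        not-free {Γ = Γ*} {Δ*} y∉ (modal∈ m∈) (there (∈-concat-tabulate⁺ _ i y∈))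

      fresh-for : ∀ {φ c} → φ ∈ Γ* ++ Δ* → Sat 𝕋 S 𝔐 v φ ⇔ Sat 𝕋 S 𝔐 (v [ y ↦ c ]) φ
      fresh-for {φ} φ∈ = Sat-fresh 𝔐 φ (not-free {Γ = Γ*} {Δ*} y∉ φ∈)

      module _ (none : ¬ Any (Sat 𝕋 S 𝔐 v) Δ*) where

        premise-true : ∀ c {Γᵢ Δᵢ} → (Γᵢ , Δᵢ) ∈ premises →
                       All (λ p → does (em {P = τ p c}) ≡ true) Γᵢ →
                       Any (λ p → does (em {P = τ p c}) ≡ true) Δᵢ
        premise-true c {Γᵢ} {Δᵢ} prem∈ trues =
          [ (λ a → let p , p∈ , s = find (Any.map⁻ a)
                   in  lose p∈ (from does-em (to (inst₀⇔τ (covered prem∈ (∈-++⁺ʳ Γᵢ p∈))) s)))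
          , (λ a → let φ , φ∈ , s = find a
                       φ∈Δ*       = ∈-++⁺ʳ (map (instΛ β z) right) φ∈
                   in  contradiction (lose φ∈Δ* (from (fresh-for (∈-++⁺ʳ Γ* φ∈Δ*)) s)) none)
          ]′ (Any.++⁻ (map (inst₀ β y) Δᵢ) (prems prem∈ 𝔐 (v [ y ↦ c ]) (All.++⁺
            (All.tabulate λ φ∈ → to (fresh-for (∈-++⁺ˡ (∈-++⁺ˡ φ∈))) (All.lookup (All.++⁻ˡ Γ γs) φ∈))
            (All.map⁺ (All.tabulate λ p∈ →
              from (inst₀⇔τ (covered prem∈ (∈-++⁺ˡ p∈))) (to does-em (All.lookup trues p∈)))))))

        A-holds : Universal (extend τ A)
        A-holds c = from (extend⇔eval τ A) (trans (premises≈A _)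
          (from (eval-⋀ _ (map (uncurry sequent) premises)) (All.map⁺ (All.tabulate
            λ {(Γᵢ , Δᵢ)} prem∈ → from (eval-sequent _ Γᵢ Δᵢ) (premise-true c prem∈)))))

        X-holds : extend κ X (γ (v z))
        X-holds = subst id (extend-bind _ X (atom ∘ mapΛ atom)) (rules-sound r τ A-holds (γ (v z)))

    sound : ∀ {Γ Δ} → Derivable S format Γ Δ → Valid 𝕋 S Γ Δ
    sound (exchange Γ↭ Δ↭ d) 𝔐 v γs = Any-resp-↭ Δ↭ (sound d 𝔐 v (All-resp-↭ (↭-sym Γ↭) γs))
    sound (axiom φ) 𝔐 v (s ∷ []) = here s
    sound bot-L 𝔐 v (() ∷ [])
    sound (≈-R x) 𝔐 v [] = here refl
    sound (⊃-R {φ = φ} {ψ = ψ} d) 𝔐 v γs with em {P = Sat 𝕋 S 𝔐 v φ}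
    ... | no ¬s = here λ s → contradiction s ¬s
    ... | yes s with sound d 𝔐 v (s ∷ γs)
    ...   | here t   = here λ _ → t
    ...   | there δs = there δs
    sound (⊃-L d e) 𝔐 v (f ∷ γs) with sound d 𝔐 v γs
    ... | here s   = sound e 𝔐 v (f s ∷ γs)
    ... | there δs = δs
    -- As for S(R), Δ is first assumed false, so that the premise yields φ at every c.
    sound (all-R {Γ = Γ} {φ = φ} {Δ = Δ} {x} y y∉ d) 𝔐 v γs = by-contradiction λ none →
      let fresh-for = λ {φ′} (φ′∈ : φ′ ∈ Γ ++ all x φ ∷ Δ) {c} →
            Sat-fresh 𝔐 φ′ {v} {y} {c} (not-free {Γ = Γ} {all x φ ∷ Δ} y∉ φ′∈)
          γs′ = λ c → All.tabulate λ φ′∈ → to (fresh-for (∈-++⁺ˡ φ′∈) {c}) (All.lookup γs φ′∈)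
      in  none (here λ c → case sound d 𝔐 (v [ y ↦ c ]) (γs′ c) of λ where
            (here s)   → to (Sat-[fresh/] 𝔐 φ
              (not-free {Γ = Γ} {all x φ ∷ Δ} y∉ (∈-++⁺ʳ Γ (here refl)))) s
            (there δs) → let φ′ , φ′∈ , s = find δs
                         in  contradiction
                               (there (lose φ′∈ (from (fresh-for (∈-++⁺ʳ Γ (there φ′∈))) s))) none)
    sound (all-L {φ = φ} z d) 𝔐 v (f ∷ γs) = sound d 𝔐 v (from (Sat-[/] 𝔐 φ) (f (v z)) ∷ γs)
    sound (≈-L₁ z d) 𝔐 v (e ∷ γs) =
      Any.map⁺ (Any.map (λ {φ} → Sat-[/]-≡ 𝔐 φ e) (Any.map⁻ (sound d 𝔐 v
        (e ∷ All.map⁺ (All.map (λ {φ} → Sat-[/]-≡ 𝔐 φ (sym e)) (All.map⁻ γs))))))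
    sound (≈-L₂ z d) 𝔐 v (e ∷ γs) =
      Any.map⁺ (Any.map (λ {φ} → Sat-[/]-≡ 𝔐 φ (sym e)) (Any.map⁻ (sound d 𝔐 v
        (e ∷ All.map⁺ (All.map (λ {φ} → Sat-[/]-≡ 𝔐 φ e) (All.map⁻ γs))))))
    sound (weak-L d) 𝔐 v (_ ∷ γs) = sound d 𝔐 v γs
    sound (weak-R d) 𝔐 v γs = there (sound d 𝔐 v γs)
    sound (contr-L d) 𝔐 v (s ∷ γs) = sound d 𝔐 v (s ∷ s ∷ γs)
    sound (contr-R d) 𝔐 v γs with sound d 𝔐 v γs
    ... | here s   = here s
    ... | there δs = δs
    sound (rule r z y β y∉ ds) 𝔐 v γs = rule-sound r z y β y∉ (λ prem∈ → sound (ds prem∈)) 𝔐 v γs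
    sound (cut {Γ₁ = Γ₁} {Δ₁ = Δ₁} d e) 𝔐 v γs with sound d 𝔐 v (All.++⁻ˡ Γ₁ γs)
    ... | here s   = Any.++⁺ʳ Δ₁ (sound e 𝔐 v (s ∷ All.++⁻ʳ Γ₁ γs))
    ... | there δs = Any.++⁺ˡ δs

-- The sequent calculus

embed : ∀ {ℓ} {D : Set ℓ} {Λ : Operators ℓ} {S : Signature Λ} → (D → Formula S) → Prp D → Formula S
embed f (atom d) = f d
embed f bot      = bot
embed f (A ⊃ B)  = embed f A ⊃ embed f B

embed-bind : ∀ {ℓ} {D E : Set ℓ} {Λ : Operators ℓ} {S : Signature Λ}
             (f : E → Formula S) A (σ : D → Prp E) →
             embed f (bind A σ) ≡ embed (embed f ∘ σ) A
embed-bind f (atom d) σ = refl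
embed-bind f bot      σ = refl
embed-bind f (A ⊃ B)  σ = cong₂ _⊃_ (embed-bind f A σ) (embed-bind f B σ)

module Calculus {ℓ : Level} {Λ : Operators ℓ} (S : Signature Λ)
                {sVar : Set ℓ} {𝓡 : Pred (OneStepRule Λ sVar) ℓ}
                (format : ∀ {R} → R ∈ₚ 𝓡 → SequentFormat R) where

  infix 4 _⊢_
  _⊢_ : List (Formula S) → List (Formula S) → Set ℓ
  _⊢_ = Derivable S format

  private
    variable
      Γ Γ′ Δ Δ′ : List (Formula S)
      φ ψ : Formula S

    split : φ ∈ Γ → ∃[ Γ′ ] Γ ↭ φ ∷ Γ′
    split φ∈ with ys , zs , refl ← ∈-∃++ φ∈ = ys ++ zs , shift _ ys zs

    absorb-L₁ : φ ∈ Γ → φ ∷ Γ ⊢ Δ → Γ ⊢ Δ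
    absorb-L₁ φ∈ d = let _ , p = split φ∈ in
      exchange (↭-sym p) ↭-refl (contr-L (exchange (prep _ p) ↭-refl d))

    absorb-R₁ : φ ∈ Δ → Γ ⊢ φ ∷ Δ → Γ ⊢ Δ
    absorb-R₁ φ∈ d = let _ , p = split φ∈ in
      exchange ↭-refl (↭-sym p) (contr-R (exchange ↭-refl (prep _ p) d))

    absorb-L : ∀ Γ → Γ ⊆ Γ′ → Γ ++ Γ′ ⊢ Δ → Γ′ ⊢ Δ
    absorb-L []      Γ⊆ d = d
    absorb-L (φ ∷ Γ) Γ⊆ d =
      absorb-L Γ (Γ⊆ ∘ there) (absorb-L₁ (∈-++⁺ʳ Γ (Γ⊆ (here refl))) d)

    absorb-R : ∀ Δ → Δ ⊆ Δ′ → Γ ⊢ Δ ++ Δ′ → Γ ⊢ Δ′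
    absorb-R []      Δ⊆ d = d
    absorb-R (φ ∷ Δ) Δ⊆ d =
      absorb-R Δ (Δ⊆ ∘ there) (absorb-R₁ (∈-++⁺ʳ Δ (Δ⊆ (here refl))) d)

    weak-L* : ∀ Γ′ → Γ ⊢ Δ → Γ′ ++ Γ ⊢ Δ
    weak-L* []       d = d
    weak-L* (φ ∷ Γ′) d = weak-L (weak-L* Γ′ d)

    weak-R* : ∀ Δ′ → Γ ⊢ Δ → Γ ⊢ Δ′ ++ Δ
    weak-R* []       d = d
    weak-R* (φ ∷ Δ′) d = weak-R (weak-R* Δ′ d)

  -- Γ′ and Δ′ are added by weakening, and Γ and Δ are then contracted into them. Sequents thus
  -- behave as pairs of finite sets.
  weaken : Γ ⊆ Γ′ → Δ ⊆ Δ′ → Γ ⊢ Δ → Γ′ ⊢ Δ′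
  weaken {Γ} {Γ′} {Δ} {Δ′} Γ⊆ Δ⊆ d =
    absorb-L Γ Γ⊆ (absorb-R Δ Δ⊆ (exchange (++-comm Γ′ Γ) (++-comm Δ′ Δ) (weak-L* Γ′ (weak-R* Δ′ d))))

  hyp : φ ∈ Γ → φ ∈ Δ → Γ ⊢ Δ
  hyp φ∈Γ φ∈Δ = weaken (λ where (here refl) → φ∈Γ) (λ where (here refl) → φ∈Δ) (axiom _)

  cut′ : Γ ⊢ φ ∷ Δ → φ ∷ Γ ⊢ Δ → Γ ⊢ Δ
  cut′ {Γ} {φ} {Δ} d e =
    weaken ([ id , id ]′ ∘ ∈-++⁻ Γ) ([ id , id ]′ ∘ ∈-++⁻ Δ) (cut d e)

  bot-R : Γ ⊢ bot ∷ Δ → Γ ⊢ Δ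
  bot-R d = cut′ d (weaken (λ where (here e) → here e) (λ ()) bot-L)

  cut* : ∀ Γ′ → All (λ φ → Γ ⊢ φ ∷ []) Γ′ → Γ′ ⊢ Δ → Γ ⊢ Δ
  cut* {Γ} {Δ} Γ′ ds d = go Γ′ ds (weaken (∈-++⁺ˡ {xs = Γ′}) id d)
    where
    go : ∀ Γ′ → All (λ φ → Γ ⊢ φ ∷ []) Γ′ → Γ′ ++ Γ ⊢ Δ → Γ ⊢ Δ
    go []       []       d = d
    go (φ ∷ Γ′) (e ∷ es) d =
      go Γ′ es (cut′ (weaken (∈-++⁺ʳ Γ′) (λ where (here eq) → here eq) e) d)

  ⊃-elim : Γ ⊢ φ ⊃ ψ ∷ Δ → φ ∷ Γ ⊢ ψ ∷ Δ
  ⊃-elim {φ = φ} {ψ} d = cut′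
    (weaken there (λ where (here e) → here e ; (there i) → there (there i)) d)
    (⊃-L (hyp (here refl) (here refl)) (hyp (here refl) (here refl)))

  ¬-elim : Γ ⊢ φ ⊃ bot ∷ Δ → φ ∷ Γ ⊢ Δ
  ¬-elim = bot-R ∘ ⊃-elim

  ¬-intro : φ ∷ Γ ⊢ Δ → Γ ⊢ φ ⊃ bot ∷ Δ
  ¬-intro = ⊃-R ∘ weak-R

  reductio : φ ⊃ bot ∷ Γ ⊢ Δ → Γ ⊢ φ ∷ Δ
  reductio d = cut′ (¬-intro (hyp (here refl) (here refl))) (weaken id there d)

  module Propositional (em : ∀ {a} → ExcludedMiddle a) where
    open Classical em

    Decides : List (Formula S) → List (Formula S) → Formula S → Set ℓ
    Decides Γ Δ φ = φ ∈ Γ ⊎ φ ∈ Δ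

    -- By cut, each φ can be put on one of the two sides without making the sequent derivable.
    saturate : ∀ φs → ¬ Γ ⊢ Δ → ∃[ Γ′ ] ∃[ Δ′ ]
               Γ ⊆ Γ′ × Δ ⊆ Δ′ × ¬ Γ′ ⊢ Δ′ × (∀ {φ} → φ ∈ φs → Decides Γ′ Δ′ φ)
    saturate {Γ} {Δ} [] nd = Γ , Δ , id , id , nd , λ ()
    saturate {Γ} {Δ} (φ ∷ φs) nd with em {P = Γ ⊢ φ ∷ Δ}
    ... | yes d =
      let Γ′ , Δ′ , Γ⊆ , Δ⊆ , nd′ , decides = saturate {φ ∷ Γ} φs (nd ∘ cut′ d)
      in  Γ′ , Δ′ , Γ⊆ ∘ there , Δ⊆ , nd′ , λ where
            (here refl) → inj₁ (Γ⊆ (here refl))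
            (there φ∈)  → decides φ∈
    ... | no ¬d =
      let Γ′ , Δ′ , Γ⊆ , Δ⊆ , nd′ , decides = saturate {Δ = φ ∷ Δ} φs ¬d
      in  Γ′ , Δ′ , Γ⊆ , Δ⊆ ∘ there , nd′ , λ where
            (here refl) → inj₂ (Δ⊆ (here refl))
            (there φ∈)  → decides φ∈

    module _ {D : Set ℓ} (f : D → Formula S) where

      -- Valuations are on D, since f need not be injective and its values need not be atomic
      -- formulas. The bound `ds` on atoms reflects that saturation decides only finitely many of
      -- them.
      record Countermodel (Γ Δ : List (Formula S)) (ds : List D) : Set ℓ where
        field
          V     : D → Bool
          left  : ∀ A → atoms A ⊆ ds → embed f A ∈ Γ → eval V A ≡ true
          right : ∀ A → atoms A ⊆ ds → embed f A ∈ Δ → eval V A ≢ true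
          -- This is how conclusions of the rules S(R), which need not be
          -- tautologies, constrain V.
          sequents : ∀ L R → L ++ R ⊆ ds → Γ ++ map f L ⊢ map f R ++ Δ →
                     All (λ d → V d ≡ true) L → Any (λ d → V d ≡ true) R

      countermodel : ¬ Γ ⊢ Δ → ∀ ds → Countermodel Γ Δ ds
      countermodel {Γ} {Δ} nd ds with saturate (map f ds) nd
      ... | Γ′ , Δ′ , Γ⊆ , Δ⊆ , nd′ , decides = record
        { V        = V
        ; left     = λ A ds⊇ A∈ → by-contradiction λ ≢true →
                       nd′ (cut′ (hyp (Γ⊆ A∈) (here refl)) (refute A ds⊇ (Bool.¬-not ≢true)))
        ; right    = λ A ds⊇ A∈ eq → nd′ (cut′ (prove A ds⊇ eq) (hyp (here refl) (Δ⊆ A∈)))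
        ; sequents = sequents
        }
        where
        V : D → Bool
        V d = does (em {P = f d ∈ Γ′})

        V-true : ∀ {d} → V d ≡ true → f d ∈ Γ′
        V-true = to does-em

        V-false : ∀ {d} → d ∈ ds → V d ≢ true → f d ∈ Δ′
        V-false d∈ ≢true =
          [ (λ ∈Γ′ → contradiction (from does-em ∈Γ′) ≢true) , id ]′ (decides (∈-map⁺ f d∈))

        -- Kalmár's lemma: the value of A under V is derivable from the decisions made on its atoms.
        prove  : ∀ A → atoms A ⊆ ds → eval V A ≡ true → Γ′ ⊢ embed f A ∷ Δ′
        refute : ∀ A → atoms A ⊆ ds → eval V A ≡ false → embed f A ∷ Γ′ ⊢ Δ′
        prove (atom d) ds⊇ eq = hyp (V-true eq) (here refl)
        prove (A ⊃ B)  ds⊇ eq with eval V A in eqA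
        ... | true  = ⊃-R (weaken there id (prove B (ds⊇ ∘ ∈-++⁺ʳ (atoms A)) eq))
        ... | false = ⊃-R (weaken id there (refute A (ds⊇ ∘ ∈-++⁺ˡ) eqA))
        refute (atom d) ds⊇ eq =
          hyp (here refl) (V-false (ds⊇ (here refl)) λ t → case trans (sym t) eq of λ ())
        refute bot      ds⊇ eq = weaken (λ where (here e) → here e) (λ ()) bot-L
        refute (A ⊃ B)  ds⊇ eq with eval V A in eqA
        ... | true  = ⊃-L (prove A (ds⊇ ∘ ∈-++⁺ˡ) eqA) (refute B (ds⊇ ∘ ∈-++⁺ʳ (atoms A)) eq)
        ... | false = case eq of λ ()

        sequents : ∀ L R → L ++ R ⊆ ds → Γ ++ map f L ⊢ map f R ++ Δ →
                   All (λ d → V d ≡ true) L → Any (λ d → V d ≡ true) R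
        sequents L R ds⊇ d trues = by-contradiction λ none → nd′ (weaken
          ([ Γ⊆ , (λ φ∈ → case ∈-map⁻ f φ∈ of λ where
              (d , d∈ , refl) → V-true (All.lookup trues d∈)) ]′ ∘ ∈-++⁻ Γ)
          ([ (λ φ∈ → case ∈-map⁻ f φ∈ of λ where
              (d , d∈ , refl) → V-false (ds⊇ (∈-++⁺ʳ L d∈)) (none ∘ lose d∈)) , Δ⊆ ]′ ∘ ∈-++⁻ (map f R))
          d)

      -- Propositional completeness, from a countermodel that decides all atoms involved.
      propositional : ∀ As Bs →
                      (∀ V → All (λ A → eval V A ≡ true) As → Any (λ B → eval V B ≡ true) Bs) →
                      map (embed f) As ⊢ map (embed f) Bs
      propositional As Bs valid = by-contradiction λ nd →
        let open Countermodel (countermodel nd (concatMap atoms (As ++ Bs)))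
            B , B∈ , t = find (valid V (All.tabulate λ {A} A∈ →
              left A (atoms⊆ (∈-++⁺ˡ A∈)) (∈-map⁺ (embed f) A∈)))
        in  right B (atoms⊆ (∈-++⁺ʳ As B∈)) (∈-map⁺ (embed f) B∈) t
        where
        atoms⊆ : ∀ {A As} → A ∈ As → atoms A ⊆ concatMap atoms As
        atoms⊆ A∈ d∈ = ∈-concat⁺′ d∈ (∈-map⁺ atoms A∈)

-- Henkin theories

module FreshSequence {ℓ : Level} {Λ : Operators ℓ} (S : Signature Λ)
                     (ws₀ : List (Signature.iVar S)) where
  open Signature S

  private
    used : ℕ → List iVar
    used zero    = ws₀
    used (suc n) = fresh (used n) ∷ used n

    used-mono : ∀ {m n} → m ≤ n → used m ⊆ used n
    used-mono {n = zero}  z≤n w∈ = w∈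
    used-mono {n = suc n} m≤n with m≤n⇒m<n∨m≡n m≤n
    ... | inj₁ (s≤s m≤n′) = there ∘ used-mono m≤n′
    ... | inj₂ refl       = id

  new : ℕ → iVar
  new n = fresh (used n)

  new-∉ : ∀ n → new n ∉ ws₀
  new-∉ n = fresh-∉ (used n) ∘ used-mono {n = n} z≤n

  private
    new-< : ∀ {m n} → m < n → new m ≢ new n
    new-< {m} {n} m<n eq = fresh-∉ (used n) (subst (_∈ used n) eq (used-mono m<n (here refl)))

    new-injective : ∀ {m n} → new m ≡ new n → m ≡ n
    new-injective {m} {n} eq with <-cmp m n
    ... | tri< m<n _ _ = contradiction eq (new-< m<n)
    ... | tri≈ _ m≡n _ = m≡n
    ... | tri> _ _ n<m = contradiction (sym eq) (new-< n<m)

  module _ (em : ∀ {a} → ExcludedMiddle a) where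

    private
      -- Since `new` is injective, each member of ws is `new m` for at most one m, and it suffices
      -- to go beyond these finitely many indices.
      eventually-∉ : ∀ ws → ∃[ N ] (∀ {n} → N ≤ n → new n ∉ ws)
      eventually-∉ []       = 0 , λ _ ()
      eventually-∉ (w ∷ ws) with em {P = ∃[ m ] new m ≡ w} | eventually-∉ ws
      ... | no ∄m          | N , ∉ws = N , λ {n} N≤n → λ where
        (here eq)  → ∄m (n , eq)
        (there w∈) → ∉ws N≤n w∈
      ... | yes (m , refl) | N , ∉ws = N ⊔ suc m , λ ≤n → λ where
        (here eq)  → <⇒≢ (≤-trans (m≤n⊔m N (suc m)) ≤n) (sym (new-injective eq))
        (there w∈) → ∉ws (≤-trans (m≤m⊔n N (suc m)) ≤n) w∈

    new-outside : ∀ ws → ∃[ n ] new n ∉ ws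
    new-outside ws = let N , ∉ws = eventually-∉ ws in N , ∉ws {N} ≤-refl

record HenkinTheory {ℓ : Level} {Λ : Operators ℓ} (S : Signature Λ) {sVar : Set ℓ}
                    {𝓡 : Pred (OneStepRule Λ sVar) ℓ} (format : ∀ {R} → R ∈ₚ 𝓡 → SequentFormat R)
                    (u : Signature.iVar S) (h : ℕ → Signature.iVar S)
                    (Task : Pred (Formula S) ℓ) (T₀ : List (Formula S)) : Set (Level.suc ℓ) where
  field
    M            : Pred (Formula S) ℓ
    M-closed     : ∀ {Γ φ} → All M Γ → Derivable S format Γ (φ ∷ []) → M φ
    M-consistent : ¬ M bot
    M-T₀         : ∀ {φ} → φ ∈ T₀ → M φ
    M-resolves   : ∀ {F} → Task F → M (all u F) ⊎ ∃[ n ] M (F [ h n / u ] ⊃ bot)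

module Henkin (em : ∀ {a} → ExcludedMiddle a)
              {ℓ : Level} {Λ : Operators ℓ} (S : Signature Λ)
              {sVar : Set ℓ} {𝓡 : Pred (OneStepRule Λ sVar) ℓ}
              (format : ∀ {R} → R ∈ₚ 𝓡 → SequentFormat R)
              (u : Signature.iVar S) (h : ℕ → Signature.iVar S) (h-outside : ∀ ws → ∃[ n ] h n ∉ ws)
              (task : ℕ → List (Formula S))
              (T₀ : List (Formula S)) (T₀-consistent : ¬ Derivable S format T₀ []) where
  open Signature S
  open Calculus S format

  private
    Irrefutable : List (Formula S) → Set ℓ
    Irrefutable T = ¬ T ⊢ []

    Resolves : List (Formula S) → Formula S → Set ℓ
    Resolves T F = all u F ∈ T ⊎ ∃[ n ] F [ h n / u ] ⊃ bot ∈ T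

    resolves-mono : ∀ {T T′ F} → T ⊆ T′ → Resolves T F → Resolves T′ F
    resolves-mono T⊆ = [ inj₁ ∘ T⊆ , (λ (n , ∈T) → inj₂ (n , T⊆ ∈T)) ]′

    -- Suppose T refutes ∀u.F and, for some h not free in T or ∀u.F, also refutes ¬F(h). Then T
    -- derives F(h), hence ∀u.F by generalization, and a cut refutes T.
    resolve : ∀ {T} → Irrefutable T → ∀ F → ∃[ T′ ] T ⊆ T′ × Irrefutable T′ × Resolves T′ F
    resolve {T} con F with em {P = all u F ∷ T ⊢ []}
    ... | no con′ = all u F ∷ T , there , con′ , inj₁ (here refl)
    ... | yes d =
      let n , n∉ = h-outside (concatMap fv (T ++ all u F ∷ []))
      in  F [ h n / u ] ⊃ bot ∷ T , there ,
          (λ d′ → con (cut′ (all-R (h n) n∉ (reductio d′)) d)) , inj₂ (n , here refl)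

    resolve-all : ∀ {T} → Irrefutable T → ∀ Fs →
                  ∃[ T′ ] T ⊆ T′ × Irrefutable T′ × (∀ {F} → F ∈ Fs → Resolves T′ F)
    resolve-all {T} con []       = T , id , con , λ ()
    resolve-all con (F ∷ Fs) =
      let T₁ , ⊆₁ , con₁ , res₁ = resolve con F
          T₂ , ⊆₂ , con₂ , res₂ = resolve-all con₁ Fs
      in  T₂ , ⊆₂ ∘ ⊆₁ , con₂ , λ where
            (here refl) → resolves-mono ⊆₂ res₁
            (there F∈)  → res₂ F∈

    chain : ℕ → ∃[ T ] Irrefutable T
    chain zero    = T₀ , T₀-consistent
    chain (suc k) = let T , _ , con , _ = resolve-all (proj₂ (chain k)) (task k) in T , con

    theory : ℕ → List (Formula S)
    theory = proj₁ ∘ chain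

    theory-mono : ∀ {j k} → j ≤ k → theory j ⊆ theory k
    theory-mono {k = zero}  z≤n = id
    theory-mono {k = suc k} j≤k with m≤n⇒m<n∨m≡n j≤k
    ... | inj₁ (s≤s j≤k′) = proj₁ (proj₂ (resolve-all (proj₂ (chain k)) (task k))) ∘ theory-mono j≤k′
    ... | inj₂ refl       = id

    common : ∀ {Γ} → All (λ φ → ∃[ k ] theory k ⊢ φ ∷ []) Γ → ∃[ k ] All (λ φ → theory k ⊢ φ ∷ []) Γ
    common [] = 0 , []
    common ((j , d) ∷ ds) =
      let k , ds′ = common ds
      in  j ⊔ k , weaken (theory-mono (m≤m⊔n j k)) id d ∷
                  All.map (weaken (theory-mono (m≤n⊔m j k)) id) ds′

    -- The deductive closure of the union of the chain: by `common`, finitely many members already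
    -- follow from a single stage.
    M : Formula S → Set ℓ
    M φ = ∃[ k ] theory k ⊢ φ ∷ []

    resolves⇒M : ∀ {k F} → Resolves (theory k) F → M (all u F) ⊎ ∃[ n ] M (F [ h n / u ] ⊃ bot)
    resolves⇒M {k} (inj₁ ∈T)       = inj₁ (k , hyp ∈T (here refl))
    resolves⇒M {k} (inj₂ (n , ∈T)) = inj₂ (n , k , hyp ∈T (here refl))

  henkin-theory : HenkinTheory S format u h (λ F → ∃[ k ] F ∈ task k) T₀
  henkin-theory = record
    { M            = M
    ; M-closed     = λ {Γ} ms d → let k , ds = common ms in k , cut* Γ ds d
    ; M-consistent = λ (k , d) → proj₂ (chain k) (bot-R d)
    ; M-T₀         = λ φ∈ → 0 , hyp φ∈ (here refl)
    -- The tasks of `task k` are resolved in passing to stage k + 1.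
    ; M-resolves   = λ (k , F∈) → resolves⇒M {suc k}
        (proj₂ (proj₂ (proj₂ (resolve-all (proj₂ (chain k)) (task k)))) F∈)
    }

-- Enumeration of the tasks

module Tasks {ℓ : Level} {Λ : Operators ℓ} (S : Signature Λ)
             (name : ℕ → Signature.iVar S) (φs : List (Formula S)) where
  open Signature S
  open Variables S

  private
    -- All maps from ws to the numbers below k, with default value 0 off ws; by `sub-cong`,
    -- agreement on the free variables of a formula is enough.
    assignments : ℕ → List iVar → List (iVar → ℕ)
    assignments k []       = (λ _ → 0) ∷ []
    assignments k (w ∷ ws) = cartesianProductWith (λ n ρ → ρ [ w ↦ n ]) (upTo k) (assignments k ws)

    assignments-complete : ∀ {k} (ρ : iVar → ℕ) ws → (∀ {w} → w ∈ ws → ρ w < k) →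
                           ∃[ ρ′ ] ρ′ ∈ assignments k ws × (∀ {w} → w ∈ ws → ρ′ w ≡ ρ w)
    assignments-complete ρ [] <k = _ , here refl , λ ()
    assignments-complete ρ (w ∷ ws) <k with assignments-complete ρ ws (<k ∘ there)
    ... | ρ′ , ρ′∈ , agree =
      ρ′ [ w ↦ ρ w ] , ∈-cartesianProductWith⁺ _ (∈-upTo⁺ (<k (here refl))) ρ′∈ , agree′
      where
      agree′ : ∀ {w′} → w′ ∈ w ∷ ws → (ρ′ [ w ↦ ρ w ]) w′ ≡ ρ w′
      agree′ {w′} w′∈ with w′ ≟ w | w′∈
      ... | yes refl | _         = refl
      ... | no w′≢w  | here eq   = contradiction eq w′≢w
      ... | no _     | there w∈  = agree w∈

    bounded : ∀ (ρ : iVar → ℕ) ws → ∃[ k ] (∀ {w} → w ∈ ws → ρ w < k)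
    bounded ρ []       = 0 , λ ()
    bounded ρ (w ∷ ws) = let k , <k = bounded ρ ws in suc (ρ w) ⊔ k , λ where
      (here refl) → m≤m⊔n _ k
      (there w∈)  → ≤-trans (<k w∈) (m≤n⊔m _ k)

    instances : ℕ → List (Formula S)
    instances k = cartesianProductWith (λ φ ρ → sub (name ∘ ρ) φ) φs (assignments k (concatMap fv φs))

  -- Increasing finite lists that exhaust the Boolean combinations of instances of `φs`; each
  -- instance enters once k exceeds the indices of the names in it.
  task : ℕ → List (Formula S)
  task zero    = bot ∷ []
  task (suc k) = task k ++ instances k ++ cartesianProductWith _⊃_ (task k) (task k)

  Task : Formula S → Set ℓ
  Task F = ∃[ k ] F ∈ task k

  private
    task-mono : ∀ {j k} → j ≤ k → task j ⊆ task k
    task-mono {k = zero}  z≤n F∈ = F∈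
    task-mono {k = suc k} j≤k F∈ with m≤n⇒m<n∨m≡n j≤k
    ... | inj₁ (s≤s j≤k′) = ∈-++⁺ˡ (task-mono j≤k′ F∈)
    ... | inj₂ refl       = F∈

  task-bot : Task bot
  task-bot = 0 , here refl

  task-⊃ : ∀ {F G} → Task F → Task G → Task (F ⊃ G)
  task-⊃ (j , F∈) (k , G∈) = suc (j ⊔ k) , ∈-++⁺ʳ (task (j ⊔ k)) (∈-++⁺ʳ (instances (j ⊔ k))
    (∈-cartesianProductWith⁺ _⊃_ (task-mono (m≤m⊔n j k) F∈) (task-mono (m≤n⊔m j k) G∈)))

  module _ (ext : ∀ {a b} → Extensionality a b) where
    open Syntax ext {S = S}

    task-sub : ∀ {φ} → φ ∈ φs → ∀ ρ → Task (sub (name ∘ ρ) φ)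
    task-sub {φ} φ∈ ρ =
      let k , <k           = bounded ρ (concatMap fv φs)
          ρ′ , ρ′∈ , agree = assignments-complete ρ (concatMap fv φs) <k
          φ≡               = sub-cong φ λ w∈ → cong name (agree (∈-concat⁺′ w∈ (∈-map⁺ fv φ∈)))
      in  suc k , ∈-++⁺ʳ (task k) (∈-++⁺ˡ (subst (_∈ instances k) φ≡ (∈-cartesianProductWith⁺ _ φ∈ ρ′∈)))

module Least (em : ∀ {a} → ExcludedMiddle a) {p} (P : ℕ → Set p) where

  IsLeast : ℕ → Set p
  IsLeast m = P m × (∀ {j} → P j → m ≤ j)

  private
    search : ∀ n → ∃[ m ] IsLeast m ⊎ (∀ {j} → j < n → ¬ P j)
    search zero = inj₂ λ ()
    search (suc n) with search n | em {P = P n}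
    ... | inj₁ found | _      = inj₁ found
    ... | inj₂ none  | yes pn = inj₁ (n , pn , λ {j} pj → ≮⇒≥ λ j<n → none j<n pj)
    ... | inj₂ none  | no ¬pn = inj₂ λ {j} j<1+n → case m≤n⇒m<n∨m≡n (≤-pred j<1+n) of λ where
      (inj₁ j<n)  → none j<n
      (inj₂ refl) → ¬pn

  least : ∀ {n} → P n → ∃[ m ] IsLeast m
  least {n} pn with search (suc n)
  ... | inj₁ found = found
  ... | inj₂ none  = contradiction pn (none ≤-refl)

subformulas : ∀ {ℓ} {Λ : Operators ℓ} {S : Signature Λ} → Formula S → List (Formula S)
subformulas φ@(x ≈ y)            = φ ∷ []
subformulas φ@(rel P xs)         = φ ∷ []
subformulas φ@bot                = φ ∷ []
subformulas φ@(ψ ⊃ χ)            = φ ∷ subformulas ψ ++ subformulas χ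
subformulas φ@(all x ψ)          = φ ∷ subformulas ψ
subformulas φ@(modal x ♡ ys ψs)  = φ ∷ concat (tabulate λ i → subformulas (ψs i))

self∈subformulas : ∀ {ℓ} {Λ : Operators ℓ} {S : Signature Λ} (φ : Formula S) → φ ∈ subformulas φ
self∈subformulas (x ≈ y)           = here refl
self∈subformulas (rel P xs)        = here refl
self∈subformulas bot               = here refl
self∈subformulas (φ ⊃ ψ)           = here refl
self∈subformulas (all x φ)         = here refl
self∈subformulas (modal x ♡ ys φs) = here refl

embed-cong : ∀ {ℓ} {D : Set ℓ} {Λ : Operators ℓ} {S : Signature Λ} {f g : D → Formula S} →
             (∀ d → f d ≡ g d) → ∀ A → embed f A ≡ embed g A
embed-cong f≗g (atom d) = f≗g d
embed-cong f≗g bot      = refl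
embed-cong f≗g (A ⊃ B)  = cong₂ _⊃_ (embed-cong f≗g A) (embed-cong f≗g B)

sub-embed : ∀ {ℓ} {D : Set ℓ} {Λ : Operators ℓ} {S : Signature Λ} ρ (f : D → Formula S) A →
            sub ρ (embed f A) ≡ embed (sub ρ ∘ f) A
sub-embed ρ f (atom d) = refl
sub-embed ρ f bot      = refl
sub-embed ρ f (A ⊃ B)  = cong₂ _⊃_ (sub-embed ρ f A) (sub-embed ρ f B)

-- The canonical model

-- Index 0 is the variable u that tasks quantify, and `h n` has index n + 1. So assignments shifted
-- by one never produce u.
names : ∀ {a} {A : Set a} → A → (ℕ → A) → ℕ → A
names u h zero    = u
names u h (suc n) = h n

module Canonical (em : ∀ {a} → ExcludedMiddle a) (ext : ∀ {a b} → Extensionality a b)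
                 {ℓ : Level} {Λ : Operators ℓ} (𝕋 : Structure Λ) (S : Signature Λ)
                 {sVar : Set ℓ} (code : Formula S ↣ sVar) {𝓡 : Pred (OneStepRule Λ sVar) ℓ}
                 (format : ∀ {R} → R ∈ₚ 𝓡 → SequentFormat R) (s1sc : S1SC 𝕋 𝓡)
                 (G : Formula S) (u : Signature.iVar S) (h : ℕ → Signature.iVar S)
                 (u∉B : u ∉ Syntax.bv ext G) (h≢u : ∀ n → h n ≢ u) (h∉B : ∀ n → h n ∉ Syntax.bv ext G)
                 (henkin-theory : HenkinTheory S format u h
                   (Tasks.Task S (names u h) (subformulas G)) (G ⊃ bot ∷ [])) where
  open Signature S
  open Operators Λ renaming (Λ to Op)
  open Structure 𝕋 hiding (T)
  open Variables S
  open Syntax ext {S = S}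
  open Calculus S format
  open Propositional em
  open Classical em
  open Tasks S (names u h) (subformulas G)
  open HenkinTheory henkin-theory

  private
    B : List iVar
    B = bv G

  open Capture-free B

  M-⊃-elim : ∀ {φ ψ} → M (φ ⊃ ψ) → M φ → M ψ
  M-⊃-elim mφψ mφ = M-closed (mφ ∷ mφψ ∷ []) (⊃-elim (hyp (here refl) (here refl)))

  Decided : Formula S → Set ℓ
  Decided φ = M φ ⊎ M (φ ⊃ bot)

  -- As M need not be maximal, a decision on φ has to be supplied.
  M-⊃-intro : ∀ {φ ψ} → Decided φ → (M φ → M ψ) → M (φ ⊃ ψ)
  M-⊃-intro (inj₁ mφ)  f = M-closed (f mφ ∷ []) (⊃-R (hyp (there (here refl)) (here refl)))
  M-⊃-intro (inj₂ m¬φ) f = M-closed (m¬φ ∷ []) (⊃-R (¬-elim (hyp (here refl) (here refl))))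

  decided-bot : Decided bot
  decided-bot = inj₂ (M-closed [] (⊃-R (hyp (here refl) (here refl))))

  decided-⊃ : ∀ {φ ψ} → Decided φ → Decided ψ → Decided (φ ⊃ ψ)
  decided-⊃ dφ         (inj₁ mψ)  = inj₁ (M-⊃-intro dφ λ _ → mψ)
  decided-⊃ (inj₂ m¬φ) (inj₂ _)   =
    inj₁ (M-⊃-intro (inj₂ m¬φ) λ mφ → contradiction (M-⊃-elim m¬φ mφ) M-consistent)
  decided-⊃ (inj₁ mφ)  (inj₂ m¬ψ) = inj₂ (M-closed (m¬ψ ∷ mφ ∷ [])
    (⊃-R (⊃-L (hyp (there (here refl)) (here refl)) (¬-elim (hyp (here refl) (here refl))))))

  M-all-elim : ∀ {x φ} z → M (all x φ) → M (φ [ z / x ])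
  M-all-elim z m = M-closed (m ∷ []) (all-L z (hyp (here refl) (here refl)))

  decided-task : ∀ {F} → Task F → u ∉ fv F → Decided F
  decided-task {F} task u∉ with M-resolves task
  ... | inj₁ m       = inj₁ (subst M (sub-absent F u∉) (M-all-elim u m))
  ... | inj₂ (n , m) = inj₂ (subst (λ φ → M (φ ⊃ bot)) (sub-absent F u∉) m)

  -- Equality in M and the points of the model

  M-≈-refl : ∀ {x} → M (x ≈ x)
  M-≈-refl {x} = M-closed [] (≈-R x)

  -- The rule `≈-L₁` replaces on both sides of a sequent. With `ψ [ h m / u ]` on the left, where u
  -- no longer occurs, and ψ on the right, only the right side changes.
  M-replace : ∀ ψ {m n} → M (h m ≈ h n) → M (ψ [ h m / u ]) → M (ψ [ h n / u ])
  M-replace ψ {m} {n} m≈n mψ = M-closed (m≈n ∷ mψ ∷ [])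
    (subst (λ χ → h m ≈ h n ∷ χ ∷ [] ⊢ ψ [ h n / u ] ∷ []) (unchanged (h n))
      (≈-L₁ {Γ = ψ [ h m / u ] ∷ []} {Δ = ψ ∷ []} u
        (hyp (there (here (sym (unchanged (h m))))) (here refl))))
    where
    unchanged : ∀ t → (ψ [ h m / u ]) [ t / u ] ≡ ψ [ h m / u ]
    unchanged t = sub-absent (ψ [ h m / u ]) (∉-fv-[/] ψ (h≢u m))

  private
    [u↦] : ∀ {t} → (id [ u ↦ t ]) u ≡ t
    [u↦] = update-≡ id

    [u↦]-h : ∀ {t} n → (id [ u ↦ t ]) (h n) ≡ h n
    [u↦]-h n = update-≢ id (h≢u n)

  M-≈-sym : ∀ {m n} → M (h m ≈ h n) → M (h n ≈ h m)
  M-≈-sym {m} {n} m≈n = subst M (cong₂ _≈_ [u↦] ([u↦]-h m))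
    (M-replace (u ≈ h m) m≈n (subst M (sym (cong₂ _≈_ [u↦] ([u↦]-h m))) M-≈-refl))

  M-≈-trans : ∀ {k m n} → M (h k ≈ h m) → M (h m ≈ h n) → M (h k ≈ h n)
  M-≈-trans {k} {m} {n} k≈m m≈n = subst M (cong₂ _≈_ ([u↦]-h k) [u↦])
    (M-replace (h k ≈ u) m≈n (subst M (sym (cong₂ _≈_ ([u↦]-h k) [u↦])) k≈m))

  private
    module Class n = Least em (λ m → M (h m ≈ h n))

    abstract
      class-least : ∀ n → ∃[ m ] Class.IsLeast n m
      class-least n = Class.least n M-≈-refl

  rep : ℕ → ℕ
  rep = proj₁ ∘ class-least

  rep-≈ : ∀ n → M (h (rep n) ≈ h n)
  rep-≈ n = proj₁ (proj₂ (class-least n))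

  abstract
    rep-cong : ∀ {m n} → M (h m ≈ h n) → rep m ≡ rep n
    rep-cong {m} {n} m≈n = ≤-antisym
      (proj₂ (proj₂ (class-least m)) (M-≈-trans (rep-≈ n) (M-≈-sym m≈n)))
      (proj₂ (proj₂ (class-least n)) (M-≈-trans (rep-≈ m) m≈n))

  -- The quotient by equality in M, realized by least indices of classes. Equality of points is then
  -- genuine identity, as the semantics of `≈` demands.
  record Point : Set ℓ where
    constructor point
    field
      num       : ℕ
      canonical : rep num ≡ num
  open Point

  Point-≡ : ∀ {c d} → num c ≡ num d → c ≡ d
  Point-≡ {point n p} {point _ q} refl = cong (point n) (≡-irrelevant p q)

  cls : ℕ → Point
  cls n = point (rep n) (rep-cong (rep-≈ n))

  cls-num : ∀ c → cls (num c) ≡ c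
  cls-num c = Point-≡ (canonical c)

  cls-≡⇔M : ∀ {m n} → cls m ≡ cls n ⇔ M (h m ≈ h n)
  cls-≡⇔M {m} {n} = mk⇔
    (λ eq → M-≈-trans (subst (λ k → M (h m ≈ h k)) (cong num eq) (M-≈-sym (rep-≈ m))) (rep-≈ n))
    (λ m≈n → Point-≡ (rep-cong m≈n))

  h-avoids : ∀ ρ → Avoids (h ∘ ρ)
  h-avoids ρ w = inj₂ (h∉B (ρ w))

  [/]-avoids : ∀ {x z} → z ∉ B → Avoids (id [ x ↦ z ])
  [/]-avoids {x} z∉B = update-avoids x (λ _ → inj₁ refl) (inj₂ z∉B)

  -- The placeholder y is used with two values: the bound variable itself, for the matrix of a
  -- binder, and u, for tasks. It differs from every `h n`, so replacing it by z reaches only what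
  -- came from x.
  sub-update-[/] : ∀ φ → bv φ ⊆ B → ∀ ρ x y {z} → y ≡ x ⊎ y ∉ B → (∀ n → h n ≢ y) → z ∉ B →
                   sub ((h ∘ ρ) [ x ↦ y ]) φ [ z / y ] ≡ sub ((h ∘ ρ) [ x ↦ z ]) φ
  sub-update-[/] φ bv⊆ ρ x y {z} y-ok h≢y z∉B =
    sub-∘ (update-avoids x (h-avoids ρ) y-ok) ([/]-avoids z∉B) φ bv⊆ (λ {w} _ → agree w)
    where
    agree : ∀ w → (id [ y ↦ z ]) (((h ∘ ρ) [ x ↦ y ]) w) ≡ ((h ∘ ρ) [ x ↦ z ]) w
    agree w with w ≟ x
    ... | yes _ = update-≡ id
    ... | no _  = update-≢ id (h≢y _)

  sub-update-h : ∀ φ ρ x n → sub ((h ∘ ρ) [ x ↦ h n ]) φ ≡ sub (h ∘ (ρ [ x ↦ n ])) φ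
  sub-update-h φ ρ x n = sub-cong φ λ {w} _ → sym (update-∘ h ρ x n w)

  M-sub-update : ∀ φ → bv φ ⊆ B → ∀ ρ x {m n} → M (h m ≈ h n) →
                 M (sub (h ∘ (ρ [ x ↦ m ])) φ) → M (sub (h ∘ (ρ [ x ↦ n ])) φ)
  M-sub-update φ bv⊆ ρ x {m} {n} m≈n =
    subst M (via n) ∘ M-replace (sub ((h ∘ ρ) [ x ↦ u ]) φ) m≈n ∘ subst M (sym (via m))
    where
    via : ∀ k → sub ((h ∘ ρ) [ x ↦ u ]) φ [ h k / u ] ≡ sub (h ∘ (ρ [ x ↦ k ])) φ
    via k = trans (sub-update-[/] φ bv⊆ ρ x u (inj₂ u∉B) h≢u (h∉B k)) (sub-update-h φ ρ x k)

  -- As ≈-L₁ replaces one variable, the values of ρ are changed to those of ρ′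
  -- one variable of φ at a time.
  M-sub-≈ : ∀ φ → bv φ ⊆ B → ∀ {ρ ρ′} → (∀ w → M (h (ρ w) ≈ h (ρ′ w))) →
            M (sub (h ∘ ρ) φ) → M (sub (h ∘ ρ′) φ)
  M-sub-≈ φ bv⊆ {ρ} {ρ′} ρ≈ρ′ m =
    subst M (sub-cong φ (cong h ∘ merge-∈ (fv φ))) (M-merge (fv φ))
    where
    merge : List iVar → iVar → ℕ
    merge []       = ρ
    merge (w ∷ ws) = merge ws [ w ↦ ρ′ w ]

    merge-≈ : ∀ ws v → M (h (merge ws v) ≈ h (ρ′ v))
    merge-≈ []       = ρ≈ρ′
    merge-≈ (w ∷ ws) =
      update-elim (merge ws) (λ v k → M (h k ≈ h (ρ′ v))) M-≈-refl (λ _ → merge-≈ ws _)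

    merge-∈ : ∀ ws {v} → v ∈ ws → merge ws v ≡ ρ′ v
    merge-∈ (w ∷ ws) {v} v∈ with v ≟ w | v∈
    ... | yes refl | _        = refl
    ... | no v≢w   | here v≡w = contradiction v≡w v≢w
    ... | no _     | there v∈ws = merge-∈ ws v∈ws

    M-merge : ∀ ws → M (sub (h ∘ merge ws) φ)
    M-merge []       = m
    M-merge (w ∷ ws) = M-sub-update φ bv⊆ (merge ws) w (merge-≈ ws w)
      (subst M (sub-cong φ λ {v} _ → cong h (sym (update-self (merge ws) w v))) (M-merge ws))

  -- The scope body of a binder of G, with the values env for its variables
  -- other than bound.
  record Body : Set ℓ where
    field
      bound  : iVar
      body   : Formula S
      env    : iVar → ℕ
      bound∈ : bound ∈ B
      body∈  : body ∈ subformulas G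
      bv⊆    : bv body ⊆ B
  open Body

  instantiate : Body → iVar → Formula S
  instantiate b z = sub ((h ∘ env b) [ bound b ↦ z ]) (body b)

  -- What remains below the binder after substitution by `h ∘ env b`, the binder keeping its name
  -- because the h are outside `B`.
  matrix : Body → Formula S
  matrix b = instantiate b (bound b)

  matrix-[/] : ∀ b {z} → z ∉ B → matrix b [ z / bound b ] ≡ instantiate b z
  matrix-[/] b = sub-update-[/] (body b) (bv⊆ b) (env b) (bound b) (bound b) (inj₁ refl)
    (λ n eq → h∉B n (subst (_∈ B) (sym eq) (bound∈ b)))

  instantiate-u-[/] : ∀ b {z} → z ∉ B → instantiate b u [ z / u ] ≡ instantiate b z
  instantiate-u-[/] b = sub-update-[/] (body b) (bv⊆ b) (env b) (bound b) u (inj₂ u∉B) h≢u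

  instantiate-h : ∀ b n → instantiate b (h n) ≡ sub (h ∘ (env b [ bound b ↦ n ])) (body b)
  instantiate-h b = sub-update-h (body b) (env b) (bound b)

  decided-sub : ∀ {φ} → φ ∈ subformulas G → ∀ ρ → Decided (sub (h ∘ ρ) φ)
  decided-sub {φ} φ∈ ρ = decided-task (task-sub ext φ∈ (suc ∘ ρ)) λ u∈ →
    let v , _ , eq = fv-sub (h ∘ ρ) φ u∈ in h≢u (ρ v) (sym eq)

  task-instantiate : ∀ b → Task (instantiate b u)
  task-instantiate b = subst Task
    (sub-cong (body b) λ {w} _ → update-∘ (names u h) (suc ∘ env b) (bound b) 0 w)
    (task-sub ext (body∈ b) ((suc ∘ env b) [ bound b ↦ 0 ]))

  -- Points suffice for the quantifier: a witness `h n` against F would by `M-replace` conflict with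
  -- F at the representative of n.
  M-all-u : ∀ {F} → Task F → (∀ c → M (F [ h (num c) / u ])) → M (all u F)
  M-all-u {F} task f with M-resolves task
  ... | inj₁ m       = m
  ... | inj₂ (n , m) = contradiction (M-⊃-elim m (M-replace F (rep-≈ n) (f (cls n)))) M-consistent

  -- The code of ∀x.χ stands for the predicate λx.χ.
  encode : Body → sVar
  encode b = Injection.to code (all (bound b) (matrix b))

  -- Different bodies can share a code, so a body is recovered only up to its bound variable and
  -- matrix. Schematic variables that code no body will stand for the empty predicate.
  decode : sVar → Maybe Body
  decode p with em {P = ∃[ b ] encode b ≡ p}
  ... | yes (b , _) = just b
  ... | no _        = nothing

  open-atom : sVar → Formula S
  open-atom p = maybe′ (λ b → instantiate b u) bot (decode p)

  open-formula : Prp sVar → Formula S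
  open-formula = embed open-atom

  -- On the code of ∀x.χ this is (x , χ) itself, not a variant of it with u for
  -- x, because the truth lemma needs the modal formula that occurs in G.
  abstraction : Prp sVar → iVar × Formula S
  abstraction (atom p) = maybe′ (λ b → bound b , matrix b) (u , bot) (decode p)
  abstraction A        = u , open-formula A

  -- Links the two readings of A: its abstraction, to which S(R) is applied, and the formula over u,
  -- which M resolves.
  abstraction-[/] : ∀ A {z} → z ∉ B →
                    let x , χ = abstraction A in χ [ z / x ] ≡ open-formula A [ z / u ]
  abstraction-[/] (atom p) z∉B with decode p
  ... | just b  = trans (matrix-[/] b z∉B) (sym (instantiate-u-[/] b z∉B))
  ... | nothing = refl
  abstraction-[/] bot      z∉B = refl
  abstraction-[/] (A ⊃ A′) z∉B = refl

  private
    all-injective : ∀ {x y} {φ ψ : Formula S} → all x φ ≡ all y ψ → x ≡ y × φ ≡ ψ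
    all-injective refl = refl , refl

  abstraction-encode : ∀ b → abstraction (atom (encode b)) ≡ (bound b , matrix b)
  abstraction-encode b with em {P = ∃[ b′ ] encode b′ ≡ encode b}
  ... | no ∄        = contradiction (b , refl) ∄
  ... | yes (_ , eq) = let x≡ , φ≡ = all-injective (Injection.injective code eq) in cong₂ _,_ x≡ φ≡

  -- The body decoded need not be b, but both have the same abstraction, through which their
  -- instances are compared.
  open-encode : ∀ b {z} → z ∉ B → open-formula (atom (encode b)) [ z / u ] ≡ instantiate b z
  open-encode b {z} z∉B =
    trans (sym (abstraction-[/] (atom (encode b)) z∉B))
    (trans (cong (λ (x , χ) → χ [ z / x ]) (abstraction-encode b)) (matrix-[/] b z∉B))

  task-open : ∀ A → Task (open-formula A)
  task-open (atom p) with decode p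
  ... | just b  = task-instantiate b
  ... | nothing = task-bot
  task-open bot     = task-bot
  task-open (A ⊃ A′) = task-⊃ (task-open A) (task-open A′)

  decided-open : ∀ A n → Decided (open-formula A [ h n / u ])
  decided-open (atom p) n with decode p
  ... | just b  = subst Decided (sym (trans (instantiate-u-[/] b (h∉B n)) (instantiate-h b n)))
                    (decided-sub (body∈ b) (env b [ bound b ↦ n ]))
  ... | nothing = decided-bot
  decided-open bot      n = decided-bot
  decided-open (A ⊃ A′) n = decided-⊃ (decided-open A n) (decided-open A′ n)

  -- One-step consistency of the modal formulas about a state

  τ : sVar → Pred Point ℓ
  τ p c = M (open-atom p [ h (num c) / u ])

  extend⇔M : ∀ A {c} → extend τ A c ⇔ M (open-formula A [ h (num c) / u ])
  extend⇔M (atom p) = mk⇔ id id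
  extend⇔M bot      = mk⇔ (λ ()) (λ m → contradiction m M-consistent)
  extend⇔M (A ⊃ A′) {c} = mk⇔
    (λ f → M-⊃-intro (decided-open A (num c)) (to (extend⇔M A′) ∘ f ∘ from (extend⇔M A)))
    (λ m → from (extend⇔M A′) ∘ M-⊃-elim m ∘ to (extend⇔M A))

  translate : ℕ → Prp (Modalized Λ (Prp sVar)) → Formula S
  translate n = embed (instΛ abstraction (h n))

  -- S(R) derives the sequent `left` ⇒ `right`, which is only Boolean equivalent to X. A
  -- countermodel to ∀u.F ⇒ X′ would respect this sequent, hence make X true, although X′ is on the
  -- right.
  M-rule-instance : ∀ {R} → R ∈ₚ 𝓡 → ∀ σ → let open OneStepRule R in
                    Universal (extend τ (bind A σ)) → ∀ n → M (translate n (bind X (atom ∘ mapΛ σ)))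
  M-rule-instance {R} r σ τ⊨A n =
    M-closed (M-all-u (task-open (bind A σ)) (λ c → to (extend⇔M (bind A σ)) (τ⊨A c)) ∷ [])
      (subst (λ φ → all u F ∷ [] ⊢ φ ∷ []) (sym (embed-bind _ X (atom ∘ mapΛ σ)))
        (by-contradiction impossible))
    where
    open OneStepRule R using (A; X)
    open SequentFormat (format r)

    β : sVar → iVar × Formula S
    β = abstraction ∘ σ

    F X′ : Formula S
    F  = open-formula (bind A σ)
    X′ = embed (instΛ β (h n)) X

    Γ* Δ* : List (Formula S)
    Γ* = all u F ∷ map (instΛ β (h n)) left
    Δ* = map (instΛ β (h n)) right ++ X′ ∷ []

    y : iVar
    -- Outside `B`, so that both readings of each `σ p` agree at y; outside the conclusion, for the
    -- side condition of S(R).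
    y = fresh (B ++ concatMap fv (Γ* ++ Δ*))

    y∉B : y ∉ B
    y∉B = fresh-∉ (B ++ concatMap fv (Γ* ++ Δ*)) ∘ ∈-++⁺ˡ

    F-[y/u] : F [ y / u ] ≡ embed (inst₀ β y) A
    F-[y/u] =
      trans (cong (sub _) (embed-bind open-atom A σ))
      (trans (sub-embed _ (open-formula ∘ σ) A)
             (embed-cong (λ p → sym (abstraction-[/] (σ p) y∉B)) A))

    -- Instantiating ∀u.F at y gives A for the formulas of the premises, and A propositionally
    -- implies each premise.
    premise : ∀ {Γᵢ Δᵢ} → (Γᵢ , Δᵢ) ∈ premises →
              all u F ∷ map (inst₀ β y) Γᵢ ⊢ map (inst₀ β y) Δᵢ ++ X′ ∷ []
    premise {Γᵢ} {Δᵢ} prem∈ = all-L y (weaken id ∈-++⁺ˡ (subst₂ _⊢_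
      (cong₂ _∷_ (sym F-[y/u]) (sym (map-∘ Γᵢ))) (sym (map-∘ Δᵢ))
      (propositional (inst₀ β y) (A ∷ map atom Γᵢ) (map atom Δᵢ) λ where
        V (A-true ∷ Γ-true) → Any.map⁺ (to (eval-sequent V Γᵢ Δᵢ)
          (All.lookup (All.map⁻ (to (eval-⋀ V (map (uncurry sequent) premises))
            (trans (sym (premises≈A V)) A-true))) prem∈) (All.map⁻ Γ-true)))))

    impossible : ¬ ¬ (all u F ∷ [] ⊢ X′ ∷ [])
    impossible nd = CM.right X (∈-++⁺ˡ) (here refl)
      (trans (concl≈X CM.V) (from (eval-sequent CM.V left right)
        (CM.sequents left right (∈-++⁺ʳ (atoms X))
          (rule r (h n) y β (fresh-∉ (B ++ concatMap fv (Γ* ++ Δ*)) ∘ ∈-++⁺ʳ B) premise))))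
      where
      module CM = Countermodel (countermodel (instΛ β (h n)) nd (atoms X ++ left ++ right))

  Ξ : ℕ → Pred (Prp (Modalized Λ (Prp sVar))) ℓ
  Ξ n φ = M (translate n φ)

  -- A Boolean refutation translates into a derivation of ⊥ from members of M, to which
  -- `M-rule-instance` adds the rule instances.
  Ξ-consistent : ∀ n → OneStepConsistent 𝕋 τ 𝓡 (Ξ n)
  Ξ-consistent n As As∈ taut = M-consistent (M-closed (All.map⁺ (All.map in-M As∈))
    (weak-R (propositional _ As [] λ V trues →
      contradiction (to (eval-⊃ V (⋀ As) bot) (taut V) (from (eval-⋀ V As) trues)) λ ())))
    where
    in-M : ∀ {φ} → Ξ n φ ⊎ RuleInstance 𝕋 τ 𝓡 φ → M (translate n φ)
    in-M (inj₁ m)             = m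
    in-M (inj₂ (inst r σ τ⊨)) = M-rule-instance r σ τ⊨ n

  private
    abstract
      witness : ∀ n → OneStepSatisfiable 𝕋 τ (Ξ n)
      witness n = s1sc τ (Ξ n) (Ξ-consistent n)

  -- The model and the truth lemma

  canonical-model : Model 𝕋 S
  canonical-model = record
    { C = Point
    ; γ = λ c → proj₁ (witness (num c))
    ; I = λ P cs → M (rel P (h ∘ num ∘ cs))
    }

  open Soundness em ext 𝕋 {S = S} using (Sat-cong)

  infix 4 _⊩_
  _⊩_ : (iVar → Point) → Formula S → Set ℓ
  v ⊩ φ = Sat 𝕋 S canonical-model v φ

  cls-rep : ∀ n → cls n ≡ cls (rep n)
  cls-rep n = from cls-≡⇔M (M-≈-sym (rep-≈ n))

  Sat-update : ∀ φ {ρ ρ′ : iVar → ℕ} x c → (∀ w → cls (ρ w) ≡ cls (ρ′ w)) →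
               (cls ∘ ρ) [ x ↦ c ] ⊩ φ ⇔ cls ∘ (ρ′ [ x ↦ num c ]) ⊩ φ
  Sat-update φ {ρ} {ρ′} x c ρ≗ρ′ =
    mk⇔ (Sat-cong canonical-model φ (λ {w} _ → agree w))
        (Sat-cong canonical-model φ (λ {w} _ → sym (agree w)))
    where
    agree : ∀ w → ((cls ∘ ρ) [ x ↦ c ]) w ≡ cls ((ρ′ [ x ↦ num c ]) w)
    agree = update-elim (cls ∘ ρ) (λ w d → d ≡ cls ((ρ′ [ x ↦ num c ]) w))
      (trans (sym (cls-num c)) (cong cls (sym (update-≡ ρ′))))
      (λ w≢x → trans (ρ≗ρ′ _) (cong cls (sym (update-≢ ρ′ w≢x))))

  -- Tasks quantify u, whereas the truth lemma concerns the binder that occurs in G. The two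
  -- matrices become equal when instantiated at a fresh variable outside `B`.
  M-rename : ∀ b → M (all u (instantiate b u)) → M (all (bound b) (matrix b))
  M-rename b m = M-closed (m ∷ []) (generalize (fresh (B ++ ws)) (fresh-∉ (B ++ ws)))
    where
    ws = concatMap fv (all u (instantiate b u) ∷ all (bound b) (matrix b) ∷ [])

    generalize : ∀ y → y ∉ B ++ ws → all u (instantiate b u) ∷ [] ⊢ all (bound b) (matrix b) ∷ []
    generalize y y∉ = all-R y (y∉ ∘ ∈-++⁺ʳ B) (all-L y (hyp (here refl) (here eq)))
      where
      eq : instantiate b u [ y / u ] ≡ matrix b [ y / bound b ]
      eq = trans (instantiate-u-[/] b (y∉ ∘ ∈-++⁺ˡ)) (sym (matrix-[/] b (y∉ ∘ ∈-++⁺ˡ)))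

  private
    Truth : Formula S → Set ℓ
    Truth φ = ∀ ρ → cls ∘ ρ ⊩ φ ⇔ M (sub (h ∘ ρ) φ)

    truth-body : ∀ b → Truth (body b) → ∀ {ρ} → (∀ w → cls (ρ w) ≡ cls (env b w)) → ∀ c →
                 (cls ∘ ρ) [ bound b ↦ c ] ⊩ body b ⇔ M (instantiate b (h (num c)))
    truth-body b ih ρ≗ c = mk⇔
      (subst M (sym (instantiate-h b (num c))) ∘ to (ih ρ′) ∘ to (Sat-update (body b) (bound b) c ρ≗))
      (from (Sat-update (body b) (bound b) c ρ≗) ∘ from (ih ρ′) ∘ subst M (instantiate-h b (num c)))
      where
      ρ′ = env b [ bound b ↦ num c ]

  truth : ∀ φ → subformulas φ ⊆ subformulas G → bv φ ⊆ B → Truth φ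
  truth (x ≈ y) sub⊆ bv⊆ ρ = cls-≡⇔M
  truth (rel P xs) sub⊆ bv⊆ ρ = mk⇔
    (M-sub-≈ (rel P xs) bv⊆ (rep-≈ ∘ ρ)) (M-sub-≈ (rel P xs) bv⊆ (M-≈-sym ∘ rep-≈ ∘ ρ))
  truth bot sub⊆ bv⊆ ρ = mk⇔ (λ ()) (λ m → contradiction m M-consistent)
  truth (φ ⊃ ψ) sub⊆ bv⊆ ρ = mk⇔
    (λ f → M-⊃-intro (decided-sub (sub⊆ (there (∈-++⁺ˡ (self∈subformulas φ)))) ρ)
                     (to ihψ ∘ f ∘ from ihφ))
    (λ m → from ihψ ∘ M-⊃-elim m ∘ to ihφ)
    where
    ihφ = truth φ (sub⊆ ∘ there ∘ ∈-++⁺ˡ) (bv⊆ ∘ ∈-++⁺ˡ) ρ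
    ihψ = truth ψ (sub⊆ ∘ there ∘ ∈-++⁺ʳ (subformulas φ)) (bv⊆ ∘ ∈-++⁺ʳ (bv φ)) ρ
  truth (all x φ) sub⊆ bv⊆ ρ = mk⇔
    (λ f → subst M (sym all≡) (M-rename b (M-all-u (task-instantiate b) λ c →
      subst M (sym (instantiate-u-[/] b (h∉B (num c)))) (to (ih c) (f c)))))
    (λ m c → from (ih c) (subst M (matrix-[/] b (h∉B (num c)))
      (M-all-elim (h (num c)) (subst M all≡ m))))
    where
    b : Body
    b = record { bound = x ; body = φ ; env = ρ ; bound∈ = bv⊆ (here refl)
               ; body∈ = sub⊆ (there (self∈subformulas φ)) ; bv⊆ = bv⊆ ∘ there }
    ih = truth-body b (truth φ (sub⊆ ∘ there) (bv⊆ ∘ there)) {ρ} λ _ → refl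
    all≡ : sub (h ∘ ρ) (all x φ) ≡ all x (matrix b)
    all≡ = sub-all (h-avoids ρ) (bv⊆ (here refl)) φ
  truth φ@(modal x ♡ ys φs) sub⊆ bv⊆ ρ = mk⇔
    (λ s → M-sub-≈ φ bv⊆ (rep-≈ ∘ ρ) ([ id , (λ m¬ → contradiction (proj₁ ≐τ s) (refuted m¬)) ]′
      (decided-sub (sub⊆ (here refl)) (rep ∘ ρ))))
    (λ m → proj₂ ≐τ (proj₂ (witness n) (atom modality) (subst M (sym modal≡)
      (M-sub-≈ φ bv⊆ (M-≈-sym ∘ rep-≈ ∘ ρ) m))))
    where
    -- The transition at the point `cls (ρ x)` was chosen for the formulas about `h n` with this n;
    -- `M-sub-≈` carries the whole environment over to `rep ∘ ρ`.
    n = rep (ρ x)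

    child⊆ : ∀ i → subformulas (φs i) ⊆ subformulas G
    child⊆ i = sub⊆ ∘ there ∘ ∈-concat-tabulate⁺ (λ i → subformulas (φs i)) i

    bv-child⊆ : ∀ i → ys i ∷ bv (φs i) ⊆ B
    bv-child⊆ i = bv⊆ ∘ ∈-concat-tabulate⁺ (λ i → ys i ∷ bv (φs i)) i

    b : ∀ i → Body
    b i = record { bound = ys i ; body = φs i ; env = rep ∘ ρ ; bound∈ = bv-child⊆ i (here refl)
                 ; body∈ = child⊆ i (self∈subformulas (φs i)) ; bv⊆ = bv-child⊆ i ∘ there }

    modality : Modalized Λ (Prp sVar)
    modality = ♡ $ (atom ∘ encode ∘ b)

    modal≡ : instΛ abstraction (h n) modality ≡ sub (h ∘ rep ∘ ρ) φ
    modal≡ = trans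
      (modal-cong refl (λ i → cong proj₁ (abstraction-encode (b i)))
                       (λ i → cong proj₂ (abstraction-encode (b i))))
      (sym (sub-modal x (h-avoids (rep ∘ ρ)) (λ i → bv-child⊆ i (here refl))))

    -- `Ξ n` contains negated modal formulas too, so the one-step model respects refusals as well as
    -- assertions of M.
    refuted : M (sub (h ∘ rep ∘ ρ) φ ⊃ bot) → ¬ ⟦ ♡ ⟧ (τ ∘ encode ∘ b) (proj₁ (witness n))
    refuted m¬ t∈ = Polymorphic.⊥-elim (proj₂ (witness n) (¬ᵇ atom modality)
      (subst (λ χ → M (χ ⊃ bot)) (sym modal≡) m¬) t∈)

    ih = λ i → truth-body (b i) (truth (φs i) (child⊆ i) (bv-child⊆ i ∘ there)) (cls-rep ∘ ρ)

    -- By the induction hypothesis, the arguments define in the model the very predicates that τ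
    -- assigns to their codes.
    ≐τ = ⟦⟧-cong ♡ {As = λ i c → (cls ∘ ρ) [ ys i ↦ c ] ⊩ φs i} {Bs = τ ∘ encode ∘ b} λ i →
      (λ {c} → subst M (sym (open-encode (b i) (h∉B (num c)))) ∘ to (ih i c)) ,
      (λ {c} → from (ih i c) ∘ subst M (open-encode (b i) (h∉B (num c))))

  countermodel-of-closed : (∀ {w} → w ∉ fv G) → ¬ cls ∘ (λ _ → 0) ⊩ G
  countermodel-of-closed closed s = M-consistent (M-⊃-elim (M-T₀ (here refl))
    (subst M (sub-fixed G (λ w∈ → contradiction w∈ closed)) (to (truth G id id (λ _ → 0)) s)))

-- Completeness, by reduction to closed formulas

module Completeness (em : ∀ {a} → ExcludedMiddle a) (ext : ∀ {a b} → Extensionality a b)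
                    {ℓ : Level} {Λ : Operators ℓ} (𝕋 : Structure Λ) (S : Signature Λ)
                    {sVar : Set ℓ} (code : Formula S ↣ sVar) {𝓡 : Pred (OneStepRule Λ sVar) ℓ}
                    (format : ∀ {R} → R ∈ₚ 𝓡 → SequentFormat R) (s1sc : S1SC 𝕋 𝓡) where
  open Signature S
  open Variables S
  open Syntax ext {S = S}
  open Calculus S format
  open Classical em

  Valid₁ : Formula S → Set (Level.suc ℓ)
  Valid₁ φ = ∀ 𝔐 v → Sat 𝕋 S 𝔐 v φ

  -- The truth lemma concerns G with its free variables replaced by the names h; closedness makes
  -- that instance G itself.
  complete-closed : ∀ G → (∀ {w} → w ∉ fv G) → Valid₁ G → [] ⊢ G ∷ []
  complete-closed G closed valid = by-contradiction λ nd → refuted nd (fresh (bv G)) (fresh-∉ (bv G))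
    where
    refuted : ¬ ([] ⊢ G ∷ []) → ∀ u → u ∉ bv G → ⊥
    refuted nd u u∉ = CM.countermodel-of-closed closed (valid CM.canonical-model _)
      where
      open FreshSequence S (u ∷ bv G) renaming (new to h; new-∉ to h-∉)
      module Th = Henkin em S format u h (new-outside em) (Tasks.task S (names u h) (subformulas G))
                    (G ⊃ bot ∷ []) (nd ∘ reductio)
      module CM = Canonical em ext 𝕋 S code format s1sc G u h u∉ (λ n → h-∉ n ∘ here)
                    (λ n → h-∉ n ∘ there) Th.henkin-theory

  generalize : Formula S → List iVar → Formula S
  generalize = foldr all

  fv-generalize : ∀ φ ws {w} → w ∈ fv (generalize φ ws) → w ∈ fv φ × w ∉ ws
  fv-generalize φ []       w∈ = w∈ , λ ()
  fv-generalize φ (x ∷ ws) w∈ =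
    let w∈′ , w≢x = ∈-remove⁻ x (fv (generalize φ ws)) w∈
        w∈φ , w∉  = fv-generalize φ ws w∈′
    in  w∈φ , λ where
          (here w≡x) → w≢x w≡x
          (there i)  → w∉ i

  valid-generalize : ∀ {φ} ws → Valid₁ φ → Valid₁ (generalize φ ws)
  valid-generalize []       valid = valid
  valid-generalize (x ∷ ws) valid 𝔐 v c = valid-generalize ws valid 𝔐 (v [ x ↦ c ])

  -- Each quantifier is instantiated with its own variable, a substitution that by `sub-id` changes
  -- nothing.
  specialize : ∀ {φ} ws → [] ⊢ generalize φ ws ∷ [] → [] ⊢ φ ∷ []
  specialize []       d = d
  specialize {φ} (x ∷ ws) d = specialize ws (cut d (all-L x
    (hyp (here refl) (here (sub-id (generalize φ ws) (update-self id x))))))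

  complete₁ : ∀ φ → Valid₁ φ → [] ⊢ φ ∷ []
  complete₁ φ valid = specialize (fv φ) (complete-closed (generalize φ (fv φ))
    (λ w∈ → let w∈φ , w∉ = fv-generalize φ (fv φ) w∈ in w∉ w∈φ) (valid-generalize (fv φ) valid))

  -- Expresses that Φ is not jointly true. A sequent Γ ⇒ Δ becomes a single formula when Φ consists
  -- of Γ and the negations of Δ.
  refutation : List (Formula S) → Formula S
  refutation = foldr _⊃_ bot

  Sat-refutation : ∀ 𝔐 v Φ → ¬ All (Sat 𝕋 S 𝔐 v) Φ → Sat 𝕋 S 𝔐 v (refutation Φ)
  Sat-refutation 𝔐 v []      no-all = contradiction [] no-all
  Sat-refutation 𝔐 v (φ ∷ Φ) no-all s = Sat-refutation 𝔐 v Φ (no-all ∘ (s ∷_))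

  refute : ∀ {Γ Δ} Φ → (∀ {φ} → φ ∈ Φ → Γ ⊢ φ ∷ Δ) → Γ ⊢ refutation Φ ∷ Δ → Γ ⊢ Δ
  refute []      ds d = bot-R d
  refute (φ ∷ Φ) ds d = refute Φ (ds ∘ there)
    (cut′ (weaken id (λ where (here e) → here e ; (there i) → there (there i)) (ds (here refl)))
          (⊃-elim d))

  complete : ∀ Γ Δ → Valid 𝕋 S Γ Δ → Γ ⊢ Δ
  complete Γ Δ valid = refute Φ proves
    (weaken (λ ()) (λ where (here e) → here e) (complete₁ (refutation Φ) valid₁))
    where
    Φ : List (Formula S)
    Φ = Γ ++ map (_⊃ bot) Δ

    valid₁ : Valid₁ (refutation Φ)
    valid₁ 𝔐 v = Sat-refutation 𝔐 v Φ λ all →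
      let ψ , ψ∈ , s = find (valid 𝔐 v (All.++⁻ˡ Γ all))
      in  Polymorphic.⊥-elim (All.lookup (All.++⁻ʳ Γ all) (∈-map⁺ (_⊃ bot) ψ∈) s)

    proves : ∀ {φ} → φ ∈ Φ → Γ ⊢ φ ∷ Δ
    proves φ∈ with ∈-++⁻ Γ φ∈
    ... | inj₁ φ∈Γ = hyp φ∈Γ (here refl)
    ... | inj₂ ¬ψ∈ with ∈-map⁻ (_⊃ bot) ¬ψ∈
    ...   | ψ , ψ∈ , refl = ¬-intro (hyp (here refl) ψ∈)

corollary6p9 : (∀ {a : Level} → ExcludedMiddle a) →
    (∀ {a b : Level} → Extensionality a b) →
    ∀ {ℓ : Level} (Λ : Operators ℓ) (𝕋 : Structure Λ) (S : Signature Λ) →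
    (sVar : Set ℓ) → Formula S ↣ sVar →
    (𝓡 : Pred (OneStepRule Λ sVar) ℓ) →
    (format : ∀ {R} → R ∈ₚ 𝓡 → SequentFormat R) →
    (∀ {R} → R ∈ₚ 𝓡 → OneStepSound 𝕋 R) →
    S1SC 𝕋 𝓡 →
    (Γ Δ : List (Formula S)) → Derivable S format Γ Δ ⇔ Valid 𝕋 S Γ Δ
corollary6p9 em ext Λ 𝕋 S sVar code 𝓡 format rules-sound s1sc Γ Δ = mk⇔
  (Soundness.sound em ext 𝕋 format rules-sound)
  (Completeness.complete em ext 𝕋 S code format s1sc Γ Δ)
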